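{- Let $M$ be a matroid of odd rank $r$. Then $$\left[t^{\lfloor (r-1)/2\rfloor}\right]P_M(t)=\left[t^{\lfloor (r-1)/2\rfloor}\right]Q_M(t).$$ In particular, a matroid $M$ of odd rank $r$ is non-degenerate if and only if $Q_M(t)$ has degree $\lfloor (r-1)/2\rfloor$.
   Context: $[t^j]p(t)$ denotes the coefficient of $t^j$ in a polynomial $p(t)$. For a matroid $M$ of rank $r$ with ground set $E$, let $\mathscr{L}(M)$ be its lattice of flats ordered by inclusion, with minimum $\hat 0$ (the closure of the empty set) and maximum $E$, rank function $\operatorname{rk}$ and Möbius function $\mu$. The characteristic polynomial is $\chi_M(t)=\sum_{F\in\mathscr{L}(M)}\mu(\hat 0,F)\,t^{r-\operatorname{rk}F}$. For a flat $F$, $M_F$ is the restriction of $M$ to $F$ (lattice of flats $[\hat 0,F]$, rank $\operatorname{rk}F$) and $M^F$ is the contraction $M/F$ (lattice of flats $[F,E]$, rank $r-\operatorname{rk}F$); all quantities depend only on the lattice of flats. The Kazhdan–Lusztig polynomial $P_M(t)$ and inverse Kazhdan–Lusztig polynomial $Q_M(t)$ are the unique assignment of polynomials in $\mathbb{Z}[t]$ to every matroid such that: if $r=0$ then $P_M=Q_M=1$; if $r>0$ then $\deg P_M<r/2$ and $\deg Q_M<r/2$; and for every $M$, $t^rP_M(t^{ -1})=\sum_{F\in\mathscr{L}(M)}\chi_{M_F}(t)P_{M^F}(t)$ and $(-1)^r t^rQ_M(t^{ -1})=\sum_{F\in\mathscr{L}(M)}(-1)^{\operatorname{rk}F}Q_{M_F}(t)\,t^{r-\operatorname{rk}F}\chi_{M^F}(t^{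 -1})$. A matroid $M$ of rank $r$ is degenerate if $\deg P_M(t)<\lfloor (r-1)/2\rfloor$, and non-degenerate otherwise. -}

module Defs where

open import Data.Bool using (Bool; true; false; if_then_else_; not; _∧_; _∨_)
open import Data.Nat as ℕ using (ℕ; zero; suc; _∸_; _≤_; _≡ᵇ_; _<ᵇ_; _≤ᵇ_)
open import Data.Nat.Base using (_/_)
open import Data.Integer as ℤ using (ℤ; 0ℤ; 1ℤ; -1ℤ)
open import Data.Fin using (Fin)
open import Data.Fin.Subset using (Subset; ⊤; ⁅_⁆; _∪_; _∩_; _⊆_; ∣_∣; inside; outside)
open import Data.Vec using (Vec; []; _∷_; lookup; tabulate)
open import Data.List using (List; []; _∷_; _++_; map; foldr; allFin; upTo; filterᵇ)
open import Data.Product using (_×_)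
open import Relation.Binary.PropositionalEquality using (_≡_)
open import Relation.Nullary using (¬_)

record RankFn : Set where
  constructor mkRankFn
  field
    n  : ℕ
    rk : Subset n → ℕ
open RankFn public

record IsMatroid (M : RankFn) : Set where
  field
    R1 : ∀ A → rk M A ≤ ∣ A ∣
    R2 : ∀ A B → A ⊆ B → rk M A ≤ rk M B
    R3 : ∀ A B → rk M (A ∪ B) ℕ.+ rk M (A ∩ B) ≤ rk M A ℕ.+ rk M B

rank : RankFn → ℕ
rank M = rk M ⊤

all : ∀ {A : Set} → (A → Bool) → List A → Bool
all p = foldr (λ x b → p x ∧ b) true

_∈ᵇ_ : ∀ {n} → Fin n → Subset n → Bool
x ∈ᵇ A = lookup A x

_⊆ᵇ_ : ∀ {n} → Subset n → Subset n → Bool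
_⊆ᵇ_ {n} A B = all (λ x → not (x ∈ᵇ A) ∨ (x ∈ᵇ B)) (allFin n)

_≟ᵇ_ : ∀ {n} → Subset n → Subset n → Bool
A ≟ᵇ B = (A ⊆ᵇ B) ∧ (B ⊆ᵇ A)

allSubsets : ∀ n → List (Subset n)
allSubsets zero    = [] ∷ []
allSubsets (suc n) = map (inside ∷_) (allSubsets n) ++ map (outside ∷_) (allSubsets n)

isFlat : (M : RankFn) → Subset (n M) → Bool
isFlat M F = all (λ x → (x ∈ᵇ F) ∨ (rk M F <ᵇ rk M (F ∪ ⁅ x ⁆))) (allFin (n M))

flats : (M : RankFn) → List (Subset (n M))
flats M = filterᵇ (isFlat M) (allSubsets (n M))

closure : (M : RankFn) → Subset (n M) → Subset (n M)
closure M A = tabulate (λ x → (x ∈ᵇ A) ∨ (rk M (A ∪ ⁅ x ⁆) ≡ᵇ rk M A))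

bot : (M : RankFn) → Subset (n M)
bot M = closure M Data.Fin.Subset.⊥

sumℤ : List ℤ → ℤ
sumℤ = foldr ℤ._+_ 0ℤ

-- Möbius function of the lattice of flats, computed by the recursion
-- μ(x,x) = 1, μ(x,y) = - Σ_{x ≤ z < y} μ(x,z) (x ≤ y), μ(x,y) = 0 otherwise.
-- The first argument is fuel; any fuel > n suffices since chains of
-- subsets of Fin n have length ≤ n + 1.
mobiusF : (M : RankFn) → ℕ → Subset (n M) → Subset (n M) → ℤ
mobiusF M zero    x y = 0ℤ
mobiusF M (suc k) x y =
  if x ≟ᵇ y then 1ℤ
  else if x ⊆ᵇ y
       then ℤ.- sumℤ (map (mobiusF M k x)
                          (filterᵇ (λ z → (x ⊆ᵇ z) ∧ (z ⊆ᵇ y) ∧ not (z ≟ᵇ y)) (flats M)))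
       else 0ℤ

mobius : (M : RankFn) → Subset (n M) → Subset (n M) → ℤ
mobius M = mobiusF M (suc (n M))

-- Polynomials in ℤ[t], represented by their coefficient sequences:
-- p j is the coefficient [t^j] p.

Poly : Set
Poly = ℕ → ℤ

one : Poly
one zero    = 1ℤ
one (suc _) = 0ℤ

_⊛_ : Poly → Poly → Poly
(p ⊛ q) j = sumℤ (map (λ i → p i ℤ.* q (j ∸ i)) (upTo (suc j)))

_·_ : ℤ → Poly → Poly
(c · p) j = c ℤ.* p j

sumP : List Poly → Poly
sumP ps j = sumℤ (map (λ p → p j) ps)

-- t^d p(t^{-1}); only used for polynomials of degree ≤ d.
reflect : ℕ → Poly → Poly
reflect d p j = if j ≤ᵇ d then p (d ∸ j) else 0ℤ

-- deg p < d   (the zero polynomial has degree -∞ < d)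
DegLt : Poly → ℕ → Set
DegLt p d = ∀ j → d ≤ j → p j ≡ 0ℤ

HasDegree : Poly → ℕ → Set
HasDegree p d = ¬ (p d ≡ 0ℤ) × DegLt p (suc d)

charPoly : RankFn → Poly
charPoly M j =
  sumℤ (map (λ F → if (rank M ∸ rk M F) ≡ᵇ j then mobius M (bot M) F else 0ℤ) (flats M))

-- Restriction M_F: same ground set, elements outside F become loops;
-- its lattice of flats is isomorphic to [0̂, F], rank = rk F.
restrict : (M : RankFn) → Subset (n M) → RankFn
restrict M F = mkRankFn (n M) (λ A → rk M (A ∩ F))

-- Contraction M/F: rank A ↦ rk(A ∪ F) - rk F; lattice of flats [F, E].
contract : (M : RankFn) → Subset (n M) → RankFn
contract M F = mkRankFn (n M) (λ A → rk M (A ∪ F) ∸ rk M F)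

sgn : ℕ → ℤ
sgn k = -1ℤ ℤ.^ k

record IsKLPair (P Q : RankFn → Poly) : Set where
  field
    rank0-P : ∀ M → IsMatroid M → rank M ≡ 0 → ∀ j → P M j ≡ one j
    rank0-Q : ∀ M → IsMatroid M → rank M ≡ 0 → ∀ j → Q M j ≡ one j
    deg-P : ∀ M → IsMatroid M → 0 ℕ.< rank M → ∀ j → rank M ≤ 2 ℕ.* j → P M j ≡ 0ℤ
    deg-Q : ∀ M → IsMatroid M → 0 ℕ.< rank M → ∀ j → rank M ≤ 2 ℕ.* j → Q M j ≡ 0ℤ
    rec-P : ∀ M → IsMatroid M → ∀ j →
      reflect (rank M) (P M) j
        ≡ sumP (map (λ F → charPoly (restrict M F) ⊛ P (contract M F)) (flats M)) j
    rec-Q : ∀ M → IsMatroid M → ∀ j →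
      (sgn (rank M) · reflect (rank M) (Q M)) j
        ≡ sumP (map (λ F → sgn (rk M F) ·
                             (Q (restrict M F) ⊛ reflect (rank M ∸ rk M F) (charPoly (contract M F))))
                    (flats M)) j

NonDegenerate : (P : RankFn → Poly) → RankFn → Set
NonDegenerate P M = ¬ DegLt (P M) ((rank M ∸ 1) / 2)

{-# OPTIONS --safe #-}
module Submission where

-- In the incidence algebra of the lattice of flats let χ be the matrix of characteristic
-- polynomials of the intervals, χʳ its reflection, and write ʳ also for the reflection of P and Q.
-- With the sign (-1)^rk absorbed into Q, the two recursions read Pʳ = χ P and Qʳ = Q χʳ.  Since
-- χ = μ ζʳ and χʳ = μʳ ζ, where μ ζ = ζ μ = 1, we get χʳ χ = 1 and so Qʳ Pʳ = Q P: the polynomial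
-- Σ_F (-1)^{rk F} Q_{M_F} P_{M^F} is palindromic of formal degree r.  For r = 2k + 1 its coefficient
-- of t^(k+1) vanishes by the degree bounds, hence so does that of t^k; but to the latter only F = 0̂
-- and F = E contribute, giving [t^k] P_M - [t^k] Q_M = 0.

open import Defs
open import Algebra.Properties.AbelianGroup using (∙-cancelʳ)
open import Data.Bool using (Bool; true; false; if_then_else_; not; _∧_; _∨_; T; _≟_)
open import Data.Bool.Properties using (∧-zeroʳ; ∨-identityʳ; ∧-identityʳ)
open import Data.Empty using (⊥-elim)
open import Data.Fin using (Fin; zero; suc)
open import Data.Fin.Subset using (Subset; ⊤; ⊥; ⁅_⁆; ∁; _∪_; _∩_; _⊆_; ∣_∣; inside; outside)
import Data.Fin.Subset.Properties as Sₚ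
open import Data.Integer using (ℤ; 0ℤ; 1ℤ; -1ℤ) renaming (_+_ to _+ℤ_; _*_ to _*ℤ_; -_ to -ℤ_)
import Data.Integer.Properties as ℤₚ
open import Data.Integer.Tactic.RingSolver using (solve-∀)
open import Data.List using (List; []; _∷_; _++_; map; filterᵇ; upTo; allFin)
open import Data.List.Properties using (map-applyUpTo; map-∘; map-cong)
open import Data.List.Membership.Propositional using () renaming (_∈_ to _∈ˡ_)
open import Data.List.Membership.Propositional.Properties using (∈-allFin)
open import Data.List.Relation.Unary.Any using (here; there)
open import Data.Nat using (ℕ; zero; suc; _∸_; _/_; _+_; _*_; _≤_; _<_; z≤n; s≤s; _≡ᵇ_; _≤ᵇ_; _<ᵇ_)
open import Data.Nat.DivMod using (m*n/n≡m)
import Data.Nat.Properties as ℕₚ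
open import Data.Nat.Tactic.RingSolver using () renaming (solve-∀ to solveℕ)
open import Data.Product using (_×_; _,_)
open import Data.Sum using (_⊎_; inj₁; inj₂)
import Data.Unit.Base as Unit
open import Data.Vec using ([]; _∷_; lookup)
import Data.Vec.Properties as Vₚ
open import Function using (_∘_)
open import Function.Bundles using (_⇔_; mk⇔)
open import Relation.Binary.PropositionalEquality
open import Relation.Nullary using (yes; no; Dec; does; ¬_)
open import Relation.Nullary.Decidable using (dec-true; dec-false)

open IsMatroid
open IsKLPair

-- The Möbius recursion yields only `μ ζ = 1`, whereas `χʳ χ = μʳ ζ μ ζʳ` needs `ζ μ = 1` in its
-- middle; unitriangularity supplies that side. The other obstacle is the identity of minors. `P`
-- and `Q` are functions of a rank function, not of a lattice: `contract (contract M F) H` and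
-- `contract M H` have pointwise equal ranks for `F ⊆ H` but are different terms, so invariance of
-- `P` and `Q` under pointwise equality has to be extracted from the recursions themselves. Moreover
-- all minors keep the ground set, so removed elements stay behind as loops: a flat of
-- `restrict M G` is a flat `A ⊆ G` of `M` with `∁ G` adjoined, and sums over flats of a restriction
-- have to be reindexed. The vanishing statements are a matter of parity: for `r = 2k + 1`, two
-- exponents bounded by half of the complementary ranks `rk F` and `r - rk F` cannot add up to
-- `k + 1`, and if both bounds are strict they cannot add up to `k` either.

infixr 7 _▷_

-- Guards take the place of filtering: sums over flats or intervals become sums over one fixed list
-- of subsets, which can be compared term by term and exchanged.
_▷_ : Bool → ℤ → ℤ
b ▷ v = if b then v else 0ℤ

▷-cong : ∀ {b c u v} → b ≡ c → (b ≡ true → u ≡ v) → b ▷ u ≡ c ▷ v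
▷-cong {true}  refl e = e refl
▷-cong {false} refl e = refl

▷-congʳ : ∀ b {u v} → (b ≡ true → u ≡ v) → b ▷ u ≡ b ▷ v
▷-congʳ b = ▷-cong {b} refl

▷-∧ : ∀ b c {v} → (b ∧ c) ▷ v ≡ b ▷ c ▷ v
▷-∧ true  c = refl
▷-∧ false c = refl

▷-zero : ∀ b {v} → (b ≡ true → v ≡ 0ℤ) → b ▷ v ≡ 0ℤ
▷-zero true  e = e refl
▷-zero false e = refl

true≢false : ∀ {b} {A : Set} → b ≡ true → b ≡ false → A
true≢false refl ()

Bool-ext : ∀ {a b} → (a ≡ true → b ≡ true) → (b ≡ true → a ≡ true) → a ≡ b
Bool-ext {true}          f g = sym (f refl)
Bool-ext {false} {true}  f g = g refl
Bool-ext {false} {false} f g = refl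

∧-intro : ∀ {a b} → a ≡ true → b ≡ true → a ∧ b ≡ true
∧-intro refl refl = refl

∧-elimˡ : ∀ {a b} → a ∧ b ≡ true → a ≡ true
∧-elimˡ {true} e = refl

∧-elimʳ : ∀ {a b} → a ∧ b ≡ true → b ≡ true
∧-elimʳ {true} e = e

T⇒true : ∀ {b} → T b → b ≡ true
T⇒true {true} _ = refl

true⇒T : ∀ {b} → b ≡ true → T b
true⇒T refl = _

≢true⇒false : ∀ {b} → b ≢ true → b ≡ false
≢true⇒false {true}  h = ⊥-elim (h refl)
≢true⇒false {false} h = refl

-- Finite sums

∑ : {A : Set} → List A → (A → ℤ) → ℤ
∑ xs f = sumℤ (map f xs)

module _ {A : Set} where

  ∑-cong : ∀ (xs : List A) {f g} → (∀ x → f x ≡ g x) → ∑ xs f ≡ ∑ xs g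
  ∑-cong xs e = cong sumℤ (map-cong e xs)

  ∑-zero : ∀ (xs : List A) {f} → (∀ x → f x ≡ 0ℤ) → ∑ xs f ≡ 0ℤ
  ∑-zero []       e = refl
  ∑-zero (x ∷ xs) e = cong₂ _+ℤ_ (e x) (∑-zero xs e)

  ∑-+ : ∀ (xs : List A) f g → ∑ xs (λ x → f x +ℤ g x) ≡ ∑ xs f +ℤ ∑ xs g
  ∑-+ []       f g = refl
  ∑-+ (x ∷ xs) f g = trans (cong (f x +ℤ g x +ℤ_) (∑-+ xs f g))
                           (interchange (f x) (g x) (∑ xs f) (∑ xs g))
    where
    interchange : ∀ a b c d → (a +ℤ b) +ℤ (c +ℤ d) ≡ (a +ℤ c) +ℤ (b +ℤ d)
    interchange = solve-∀

  ∑-*ˡ : ∀ (xs : List A) c f → ∑ xs (λ x → c *ℤ f x) ≡ c *ℤ ∑ xs f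
  ∑-*ˡ []       c f = sym (ℤₚ.*-zeroʳ c)
  ∑-*ˡ (x ∷ xs) c f = trans (cong (c *ℤ f x +ℤ_) (∑-*ˡ xs c f))
                            (sym (ℤₚ.*-distribˡ-+ c (f x) (∑ xs f)))

  ∑-*ʳ : ∀ (xs : List A) c f → ∑ xs (λ x → f x *ℤ c) ≡ ∑ xs f *ℤ c
  ∑-*ʳ xs c f = trans (∑-cong xs (λ x → ℤₚ.*-comm (f x) c))
                      (trans (∑-*ˡ xs c f) (ℤₚ.*-comm c (∑ xs f)))

  ∑-▷ : ∀ (xs : List A) b f → ∑ xs (λ x → b ▷ f x) ≡ b ▷ ∑ xs f
  ∑-▷ xs true  f = refl
  ∑-▷ xs false f = ∑-zero xs (λ _ → refl)

  ∑-filter : ∀ (xs : List A) p f → ∑ (filterᵇ p xs) f ≡ ∑ xs (λ x → p x ▷ f x)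
  ∑-filter []       p f = refl
  ∑-filter (x ∷ xs) p f with p x
  ... | true  = cong (f x +ℤ_) (∑-filter xs p f)
  ... | false = trans (∑-filter xs p f) (sym (ℤₚ.+-identityˡ _))

  ∑-++ : ∀ (xs ys : List A) f → ∑ (xs ++ ys) f ≡ ∑ xs f +ℤ ∑ ys f
  ∑-++ []       ys f = sym (ℤₚ.+-identityˡ _)
  ∑-++ (x ∷ xs) ys f = trans (cong (f x +ℤ_) (∑-++ xs ys f)) (sym (ℤₚ.+-assoc (f x) _ _))

∑-map : ∀ {A B : Set} (h : A → B) xs f → ∑ (map h xs) f ≡ ∑ xs (f ∘ h)
∑-map h xs f = cong sumℤ (sym (map-∘ xs))

∑-swap : ∀ {A B : Set} (xs : List A) (ys : List B) (f : A → B → ℤ) →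
         ∑ xs (λ x → ∑ ys (f x)) ≡ ∑ ys (λ y → ∑ xs (λ x → f x y))
∑-swap []       ys f = sym (∑-zero ys (λ _ → refl))
∑-swap (x ∷ xs) ys f = trans (cong (∑ ys (f x) +ℤ_) (∑-swap xs ys f))
                             (sym (∑-+ ys (f x) (λ y → ∑ xs (λ x → f x y))))

-- Polynomials

infix 4 _≈_

_≈_ : Poly → Poly → Set
p ≈ q = ∀ j → p j ≡ q j

tail : Poly → Poly
tail p j = p (suc j)

mono : ℤ → ℕ → Poly
mono c a j = if a ≡ᵇ j then c else 0ℤ

mask : Bool → Poly → Poly
mask b p j = b ▷ p j

∑ᴾ : {A : Set} → List A → (A → Poly) → Poly
∑ᴾ xs f j = ∑ xs (λ x → f x j)

sumP-map : ∀ {A : Set} (f : A → Poly) xs → sumP (map f xs) ≈ ∑ᴾ xs f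
sumP-map f xs j = ∑-map f xs (λ p → p j)

⊛-zero : ∀ p q → (p ⊛ q) 0 ≡ p 0 *ℤ q 0
⊛-zero p q = ℤₚ.+-identityʳ _

-- This is `p = p 0 + t * tail p` multiplied out; the inductions on convolutions below run along it.
⊛-suc : ∀ p q j → (p ⊛ q) (suc j) ≡ p 0 *ℤ q (suc j) +ℤ (tail p ⊛ q) j
⊛-suc p q j = cong (p 0 *ℤ q (suc j) +ℤ_) (cong sumℤ
  (trans (map-applyUpTo suc (λ i → p i *ℤ q (suc j ∸ i)) (suc j))
         (sym (map-applyUpTo (λ i → i) (λ i → tail p i *ℤ q (j ∸ i)) (suc j)))))

⊛-cong : ∀ {p p′ q q′} → p ≈ p′ → q ≈ q′ → p ⊛ q ≈ p′ ⊛ q′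
⊛-cong e f j = ∑-cong (upTo (suc j)) (λ i → cong₂ _*ℤ_ (e i) (f (j ∸ i)))

⊛-congˡ : ∀ p {q q′} → q ≈ q′ → p ⊛ q ≈ p ⊛ q′
⊛-congˡ p = ⊛-cong {p} (λ _ → refl)

⊛-congʳ : ∀ {p p′} q → p ≈ p′ → p ⊛ q ≈ p′ ⊛ q
⊛-congʳ q e = ⊛-cong {q = q} e (λ _ → refl)

-- The hypothesis speaks of single pairs of exponents rather than of degrees, so that a different
-- factor may be the vanishing one for each pair.
⊛-vanish : ∀ p q j → (∀ i l → i + l ≡ j → p i ≡ 0ℤ ⊎ q l ≡ 0ℤ) → (p ⊛ q) j ≡ 0ℤ
⊛-vanish p q zero    h = trans (⊛-zero p q) (product (h 0 0 refl))
  where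
  product : p 0 ≡ 0ℤ ⊎ q 0 ≡ 0ℤ → p 0 *ℤ q 0 ≡ 0ℤ
  product (inj₁ e) = cong (_*ℤ q 0) e
  product (inj₂ e) = trans (cong (p 0 *ℤ_) e) (ℤₚ.*-zeroʳ (p 0))
⊛-vanish p q (suc j) h = trans (⊛-suc p q j)
  (cong₂ _+ℤ_ (product (h 0 (suc j) refl))
               (⊛-vanish (tail p) q j (λ i l e → h (suc i) l (cong suc e))))
  where
  product : p 0 ≡ 0ℤ ⊎ q (suc j) ≡ 0ℤ → p 0 *ℤ q (suc j) ≡ 0ℤ
  product (inj₁ e) = cong (_*ℤ q (suc j)) e
  product (inj₂ e) = trans (cong (p 0 *ℤ_) e) (ℤₚ.*-zeroʳ (p 0))

⊛-∑ˡ : ∀ {A : Set} (xs : List A) f q → ∑ᴾ xs f ⊛ q ≈ ∑ᴾ xs (λ x → f x ⊛ q)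
⊛-∑ˡ xs f q j = trans
  (∑-cong (upTo (suc j)) (λ i → sym (∑-*ʳ xs (q (j ∸ i)) (λ x → f x i))))
  (∑-swap (upTo (suc j)) xs (λ i x → f x i *ℤ q (j ∸ i)))

⊛-∑ʳ : ∀ {A : Set} (xs : List A) p f → p ⊛ ∑ᴾ xs f ≈ ∑ᴾ xs (λ x → p ⊛ f x)
⊛-∑ʳ xs p f j = trans
  (∑-cong (upTo (suc j)) (λ i → sym (∑-*ˡ xs (p i) (λ x → f x (j ∸ i)))))
  (∑-swap (upTo (suc j)) xs (λ i x → p i *ℤ f x (j ∸ i)))

⊛-+ˡ : ∀ p p′ q j → ((λ i → p i +ℤ p′ i) ⊛ q) j ≡ (p ⊛ q) j +ℤ (p′ ⊛ q) j
⊛-+ˡ p p′ q j = trans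
  (∑-cong (upTo (suc j)) (λ i → ℤₚ.*-distribʳ-+ (q (j ∸ i)) (p i) (p′ i)))
  (∑-+ (upTo (suc j)) (λ i → p i *ℤ q (j ∸ i)) (λ i → p′ i *ℤ q (j ∸ i)))

⊛-·ˡ : ∀ c p q → (c · p) ⊛ q ≈ c · (p ⊛ q)
⊛-·ˡ c p q j = trans
  (∑-cong (upTo (suc j)) (λ i → ℤₚ.*-assoc c (p i) (q (j ∸ i))))
  (∑-*ˡ (upTo (suc j)) c (λ i → p i *ℤ q (j ∸ i)))

⊛-maskˡ : ∀ b p q → mask b p ⊛ q ≈ mask b (p ⊛ q)
⊛-maskˡ true  p q j = refl
⊛-maskˡ false p q j = ∑-zero (upTo (suc j)) (λ i → refl)

⊛-maskʳ : ∀ b p q → p ⊛ mask b q ≈ mask b (p ⊛ q)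
⊛-maskʳ true  p q j = refl
⊛-maskʳ false p q j = ∑-zero (upTo (suc j)) (λ i → ℤₚ.*-zeroʳ (p i))

-- Since `tail (p ⊛ q)` is `p 0 · tail q` plus `tail p ⊛ q`, associativity at `suc j` reduces to
-- associativity for `tail p` at `j` and to distributivity.
⊛-assoc : ∀ p q s → (p ⊛ q) ⊛ s ≈ p ⊛ (q ⊛ s)
⊛-assoc p q s zero = begin
  ((p ⊛ q) ⊛ s) 0              ≡⟨ ⊛-zero (p ⊛ q) s ⟩
  (p ⊛ q) 0 *ℤ s 0            ≡⟨ cong (_*ℤ s 0) (⊛-zero p q) ⟩
  p 0 *ℤ q 0 *ℤ s 0          ≡⟨ ℤₚ.*-assoc (p 0) (q 0) (s 0) ⟩
  p 0 *ℤ (q 0 *ℤ s 0)        ≡⟨ cong (p 0 *ℤ_) (⊛-zero q s) ⟨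
  p 0 *ℤ (q ⊛ s) 0            ≡⟨ ⊛-zero p (q ⊛ s) ⟨
  (p ⊛ (q ⊛ s)) 0              ∎
  where open ≡-Reasoning
⊛-assoc p q s (suc j) = begin
  ((p ⊛ q) ⊛ s) (suc j)
    ≡⟨ ⊛-suc (p ⊛ q) s j ⟩
  (p ⊛ q) 0 *ℤ s (suc j) +ℤ (tail (p ⊛ q) ⊛ s) j
    ≡⟨ cong₂ _+ℤ_ (cong (_*ℤ s (suc j)) (⊛-zero p q)) (⊛-congʳ s (⊛-suc p q) j) ⟩
  p 0 *ℤ q 0 *ℤ s (suc j) +ℤ ((λ i → (p 0 · tail q) i +ℤ (tail p ⊛ q) i) ⊛ s) j
    ≡⟨ cong (p 0 *ℤ q 0 *ℤ s (suc j) +ℤ_) (⊛-+ˡ (p 0 · tail q) (tail p ⊛ q) s j) ⟩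
  p 0 *ℤ q 0 *ℤ s (suc j) +ℤ (((p 0 · tail q) ⊛ s) j +ℤ ((tail p ⊛ q) ⊛ s) j)
    ≡⟨ cong₂ (λ u v → p 0 *ℤ q 0 *ℤ s (suc j) +ℤ (u +ℤ v))
             (⊛-·ˡ (p 0) (tail q) s j) (⊛-assoc (tail p) q s j) ⟩
  p 0 *ℤ q 0 *ℤ s (suc j) +ℤ (p 0 *ℤ (tail q ⊛ s) j +ℤ (tail p ⊛ (q ⊛ s)) j)
    ≡⟨ regroup (p 0) (q 0) (s (suc j)) _ _ ⟩
  p 0 *ℤ (q 0 *ℤ s (suc j) +ℤ (tail q ⊛ s) j) +ℤ (tail p ⊛ (q ⊛ s)) j
    ≡⟨ cong (λ u → p 0 *ℤ u +ℤ (tail p ⊛ (q ⊛ s)) j) (⊛-suc q s j) ⟨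
  p 0 *ℤ (q ⊛ s) (suc j) +ℤ (tail p ⊛ (q ⊛ s)) j
    ≡⟨ ⊛-suc p (q ⊛ s) j ⟨
  (p ⊛ (q ⊛ s)) (suc j) ∎
  where
  open ≡-Reasoning
  regroup : ∀ a b c d e → a *ℤ b *ℤ c +ℤ (a *ℤ d +ℤ e) ≡ a *ℤ (b *ℤ c +ℤ d) +ℤ e
  regroup = solve-∀

const-⊛ : ∀ p q → (∀ j → tail p j ≡ 0ℤ) → p ⊛ q ≈ p 0 · q
const-⊛ p q h zero    = ⊛-zero p q
const-⊛ p q h (suc j) = trans (⊛-suc p q j) (trans
  (cong (p 0 *ℤ q (suc j) +ℤ_) (⊛-vanish (tail p) q j (λ i _ _ → inj₁ (h i))))
  (ℤₚ.+-identityʳ _))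

one-⊛ : ∀ q → one ⊛ q ≈ q
one-⊛ q j = trans (const-⊛ one q (λ _ → refl) j) (ℤₚ.*-identityˡ (q j))

⊛-one : ∀ p → p ⊛ one ≈ p
⊛-one p zero    = trans (⊛-zero p one) (ℤₚ.*-identityʳ (p 0))
⊛-one p (suc j) = trans (⊛-suc p one j)
  (trans (cong₂ _+ℤ_ (ℤₚ.*-zeroʳ (p 0)) (⊛-one (tail p) j)) (ℤₚ.+-identityˡ _))

mono-⊛-mono : ∀ c a d b → mono c a ⊛ mono d b ≈ mono (c *ℤ d) (a + b)
mono-⊛-mono c zero    d b j = trans (const-⊛ (mono c 0) (mono d b) (λ _ → refl) j) (scale (b ≡ᵇ j))
  where
  scale : ∀ e → c *ℤ (if e then d else 0ℤ) ≡ (if e then c *ℤ d else 0ℤ)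
  scale true  = refl
  scale false = ℤₚ.*-zeroʳ c
mono-⊛-mono c (suc a) d b zero    = ⊛-zero (mono c (suc a)) (mono d b)
mono-⊛-mono c (suc a) d b (suc j) =
  trans (⊛-suc (mono c (suc a)) (mono d b) j)
        (trans (ℤₚ.+-identityˡ _) (mono-⊛-mono c a d b j))

reflect-at : ∀ j l p → reflect (j + l) p j ≡ p l
reflect-at j l p rewrite T⇒true (ℕₚ.≤⇒≤ᵇ (ℕₚ.m≤m+n j l)) = cong p (ℕₚ.m+n∸m≡n j l)

reflect-beyond : ∀ d p {j} → d < j → reflect d p j ≡ 0ℤ
reflect-beyond d p {j} d<j
  rewrite ≢true⇒false {j ≤ᵇ d} (λ e → ℕₚ.<⇒≱ d<j (ℕₚ.≤ᵇ⇒≤ j d (true⇒T e))) = refl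

-- Reflection of polynomials

reflect-cong : ∀ d {p q} → p ≈ q → reflect d p ≈ reflect d q
reflect-cong d e j = ▷-congʳ (j ≤ᵇ d) (λ _ → e (d ∸ j))

reflect-∑ : ∀ {A : Set} d (xs : List A) f → reflect d (∑ᴾ xs f) ≈ ∑ᴾ xs (λ x → reflect d (f x))
reflect-∑ d xs f j = sym (∑-▷ xs (j ≤ᵇ d) (λ x → f x (d ∸ j)))

reflect-· : ∀ d c p → reflect d (c · p) ≈ c · reflect d p
reflect-· d c p j with j ≤ᵇ d
... | true  = refl
... | false = sym (ℤₚ.*-zeroʳ c)

reflect-+ : ∀ d p q → reflect d (λ i → p i +ℤ q i) ≈ (λ i → reflect d p i +ℤ reflect d q i)
reflect-+ d p q j with j ≤ᵇ d
... | true  = refl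
... | false = refl

reflect-mask : ∀ d b p → reflect d (mask b p) ≈ mask b (reflect d p)
reflect-mask d true  p j = refl
reflect-mask d false p j with j ≤ᵇ d
... | true  = refl
... | false = refl

reflect-shift : ∀ a d p j → reflect (a + d) p (a + j) ≡ reflect d p j
reflect-shift zero    d p j = refl
reflect-shift (suc a) d p j =
  trans (cong (_▷ p (a + d ∸ (a + j))) (<ᵇ-suc (a + j))) (reflect-shift a d p j)
  where
  <ᵇ-suc : ∀ m {n} → (m <ᵇ suc n) ≡ (m ≤ᵇ n)
  <ᵇ-suc zero    = refl
  <ᵇ-suc (suc m) = refl

-- In the case `within` the degree is the sum `j + l`, the form in which `reflect-at` evaluates a
-- reflection without truncated subtraction.
data Position (j d : ℕ) : Set where
  within : ∀ l → j + l ≡ d → Position j d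
  beyond : d < j → Position j d

position : ∀ j d → Position j d
position j d with j ℕₚ.≤? d
... | yes j≤d = within (d ∸ j) (ℕₚ.m+[n∸m]≡n j≤d)
... | no  j≰d = beyond (ℕₚ.≰⇒> j≰d)

mono-at : ∀ c a → mono c a a ≡ c
mono-at c a rewrite T⇒true (ℕₚ.≡⇒≡ᵇ a a refl) = refl

mono-off : ∀ c {a j} → a ≢ j → mono c a j ≡ 0ℤ
mono-off c {a} {j} a≢j
  rewrite ≢true⇒false {a ≡ᵇ j} (λ e → a≢j (ℕₚ.≡ᵇ⇒≡ a j (true⇒T e))) = refl

-- Reversal of `p = p 0 + t * tail p`: the constant term becomes the leading one.
reflect-suc : ∀ d p → reflect (suc d) p ≈ (λ j → reflect d (tail p) j +ℤ mono (p 0) (suc d) j)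
reflect-suc d p j with position j d
... | within l refl = begin
  reflect (suc (j + l)) p j                                  ≡⟨ cong (λ e → reflect e p j) (ℕₚ.+-suc j l) ⟨
  reflect (j + suc l) p j                                    ≡⟨ reflect-at j (suc l) p ⟩
  p (suc l)                                                  ≡⟨ ℤₚ.+-identityʳ _ ⟨
  p (suc l) +ℤ 0ℤ
    ≡⟨ cong₂ _+ℤ_ (reflect-at j l (tail p)) (mono-off (p 0) (λ e → ℕₚ.m+1+n≢m j (trans (ℕₚ.+-suc j l) e))) ⟨
  reflect (j + l) (tail p) j +ℤ mono (p 0) (suc (j + l)) j   ∎
  where open ≡-Reasoning
... | beyond d<j with ℕₚ.m≤n⇒m<n∨m≡n d<j
...   | inj₁ sd<j = trans (reflect-beyond (suc d) p sd<j)
        (sym (cong₂ _+ℤ_ (reflect-beyond d (tail p) d<j) (mono-off (p 0) (ℕₚ.<⇒≢ sd<j))))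
...   | inj₂ refl = begin
  reflect (suc d) p (suc d)                                  ≡⟨ cong (λ e → reflect e p (suc d)) (ℕₚ.+-identityʳ (suc d)) ⟨
  reflect (suc d + 0) p (suc d)                              ≡⟨ reflect-at (suc d) 0 p ⟩
  p 0                                                        ≡⟨ ℤₚ.+-identityˡ _ ⟨
  0ℤ +ℤ p 0
    ≡⟨ cong₂ _+ℤ_ (reflect-beyond d (tail p) d<j) (mono-at (p 0) (suc d)) ⟨
  reflect d (tail p) (suc d) +ℤ mono (p 0) (suc d) (suc d)   ∎
  where open ≡-Reasoning

mono-⊛-at : ∀ c a s j → (mono c a ⊛ s) (a + j) ≡ c *ℤ s j
mono-⊛-at c zero    s j = const-⊛ (mono c 0) s (λ _ → refl) j
mono-⊛-at c (suc a) s j =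
  trans (⊛-suc (mono c (suc a)) s (a + j)) (trans (ℤₚ.+-identityˡ _) (mono-⊛-at c a s j))

DegLe : Poly → ℕ → Set
DegLe p d = ∀ j → d < j → p j ≡ 0ℤ

-- The left side has no coefficients below `a`. On the right those are coefficients of `q` beyond
-- `b`, which the degree bound kills.
mono-⊛-reflect : ∀ c a b q → DegLe q b → mono c a ⊛ reflect b q ≈ c · reflect (a + b) q
mono-⊛-reflect c a b q dq j with position a j
... | within i refl =
  trans (mono-⊛-at c a (reflect b q) i) (cong (c *ℤ_) (sym (reflect-shift a b q i)))
... | beyond j<a with position j (a + b)
...   | beyond ab<j = ⊥-elim (ℕₚ.<⇒≱ ab<j (ℕₚ.≤-trans (ℕₚ.<⇒≤ j<a) (ℕₚ.m≤m+n a b)))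
...   | within l j+l≡a+b = trans
  (⊛-vanish (mono c a) (reflect b q) j
    (λ i h i+h≡j → inj₁ (mono-off c {a} λ { refl → ℕₚ.<⇒≱ j<a (subst (a ≤_) i+h≡j (ℕₚ.m≤m+n a h)) })))
  (sym (trans (cong (c *ℤ_) (trans (cong (λ d → reflect d q j) (sym j+l≡a+b))
                                   (trans (reflect-at j l q) (dq l b<l))))
              (ℤₚ.*-zeroʳ c)))
  where
  b<l : b < l
  b<l = ℕₚ.+-cancelˡ-< j b l (subst (j + b <_) (sym j+l≡a+b) (ℕₚ.+-monoˡ-< b j<a))

-- Reflection drops coefficients above its formal degree, hence the two bounds. The induction on `a`
-- peels off `p 0`, whose reflection is the monomial handled by `mono-⊛-reflect`.
reflect-⊛ : ∀ a b p q → DegLe p a → DegLe q b →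
            reflect (a + b) (p ⊛ q) ≈ reflect a p ⊛ reflect b q
reflect-⊛ zero b p q dp dq j = begin
  reflect b (p ⊛ q) j            ≡⟨ reflect-cong b (const-⊛ p q (λ i → dp (suc i) (s≤s z≤n))) j ⟩
  reflect b (p 0 · q) j          ≡⟨ reflect-· b (p 0) q j ⟩
  p 0 *ℤ reflect b q j           ≡⟨ const-⊛ (reflect 0 p) (reflect b q) (λ _ → refl) j ⟨
  (reflect 0 p ⊛ reflect b q) j  ∎
  where open ≡-Reasoning
reflect-⊛ (suc a) b p q dp dq j = begin
  reflect (suc (a + b)) (p ⊛ q) j
    ≡⟨ reflect-suc (a + b) (p ⊛ q) j ⟩
  reflect (a + b) (tail (p ⊛ q)) j +ℤ mono ((p ⊛ q) 0) (suc (a + b)) j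
    ≡⟨ cong₂ _+ℤ_ (trans (reflect-cong (a + b) (⊛-suc p q) j)
                         (reflect-+ (a + b) (p 0 · tail q) (tail p ⊛ q) j))
                  (trans (cong (λ c → mono c (suc (a + b)) j) (⊛-zero p q)) (mono-* (p 0) (q 0) (suc (a + b)))) ⟩
  (reflect (a + b) (p 0 · tail q) j +ℤ reflect (a + b) (tail p ⊛ q) j) +ℤ p 0 *ℤ mono (q 0) (suc (a + b)) j
    ≡⟨ cong (λ u → (u +ℤ reflect (a + b) (tail p ⊛ q) j) +ℤ p 0 *ℤ mono (q 0) (suc (a + b)) j)
            (reflect-· (a + b) (p 0) (tail q) j) ⟩
  (p 0 *ℤ reflect (a + b) (tail q) j +ℤ reflect (a + b) (tail p ⊛ q) j) +ℤ p 0 *ℤ mono (q 0) (suc (a + b)) j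
    ≡⟨ regroup (p 0) _ _ _ ⟩
  reflect (a + b) (tail p ⊛ q) j +ℤ p 0 *ℤ (reflect (a + b) (tail q) j +ℤ mono (q 0) (suc (a + b)) j)
    ≡⟨ cong₂ (λ u v → u +ℤ p 0 *ℤ v)
             (reflect-⊛ a b (tail p) q (λ i h → dp (suc i) (s≤s h)) dq j)
             (sym (reflect-suc (a + b) q j)) ⟩
  (reflect a (tail p) ⊛ reflect b q) j +ℤ p 0 *ℤ reflect (suc a + b) q j
    ≡⟨ cong ((reflect a (tail p) ⊛ reflect b q) j +ℤ_) (mono-⊛-reflect (p 0) (suc a) b q dq j) ⟨
  (reflect a (tail p) ⊛ reflect b q) j +ℤ (mono (p 0) (suc a) ⊛ reflect b q) j
    ≡⟨ ⊛-+ˡ (reflect a (tail p)) (mono (p 0) (suc a)) (reflect b q) j ⟨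
  ((λ i → reflect a (tail p) i +ℤ mono (p 0) (suc a) i) ⊛ reflect b q) j
    ≡⟨ ⊛-congʳ (reflect b q) (reflect-suc a p) j ⟨
  (reflect (suc a) p ⊛ reflect b q) j ∎
  where
  open ≡-Reasoning
  mono-* : ∀ c d e → mono (c *ℤ d) e j ≡ c *ℤ mono d e j
  mono-* c d e with e ≡ᵇ j
  ... | true  = refl
  ... | false = sym (ℤₚ.*-zeroʳ c)
  regroup : ∀ a b c d → (a *ℤ b +ℤ c) +ℤ a *ℤ d ≡ c +ℤ a *ℤ (b +ℤ d)
  regroup = solve-∀

-- Subsets

infix 4 _≼_

-- Inclusion in terms of Boolean entries, matching the tests `_⊆ᵇ_` and `isFlat`; as a record it
-- lets `A` and `B` be inferred.
record _≼_ {n} (A B : Subset n) : Set where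
  constructor incl
  field at : ∀ i → lookup A i ≡ true → lookup B i ≡ true

open _≼_

module _ {n : ℕ} where

  ≼⇒⊆ : {A B : Subset n} → A ≼ B → A ⊆ B
  ≼⇒⊆ {B = B} h {i} i∈A = Vₚ.lookup⇒[]= i B (at h i (Vₚ.[]=⇒lookup i∈A))

  ⊆⇒≼ : {A B : Subset n} → A ⊆ B → A ≼ B
  ⊆⇒≼ {A} h = incl λ i e → Vₚ.[]=⇒lookup (h (Vₚ.lookup⇒[]= i A e))

  ≼-refl : (A : Subset n) → A ≼ A
  ≼-refl A = incl λ i e → e

  ≼-trans : {A B C : Subset n} → A ≼ B → B ≼ C → A ≼ C
  ≼-trans f g = incl λ i e → at g i (at f i e)

  ≼-antisym : {A B : Subset n} → A ≼ B → B ≼ A → A ≡ B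
  ≼-antisym f g = Sₚ.⊆-antisym (≼⇒⊆ f) (≼⇒⊆ g)

  lookup-∪ : ∀ (A B : Subset n) i → lookup (A ∪ B) i ≡ lookup A i ∨ lookup B i
  lookup-∪ A B i = Vₚ.lookup-zipWith _∨_ i A B

  lookup-∩ : ∀ (A B : Subset n) i → lookup (A ∩ B) i ≡ lookup A i ∧ lookup B i
  lookup-∩ A B i = Vₚ.lookup-zipWith _∧_ i A B

  lookup-∁ : ∀ (A : Subset n) i → lookup (∁ A) i ≡ not (lookup A i)
  lookup-∁ A i = Vₚ.lookup-map i not A

  subset-ext : {A B : Subset n} → (∀ i → lookup A i ≡ lookup B i) → A ≡ B
  subset-ext {A} {B} e =
    trans (sym (Vₚ.tabulate∘lookup A)) (trans (Vₚ.tabulate-cong e) (Vₚ.tabulate∘lookup B))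

  ∪-upperˡ : ∀ (A B : Subset n) → A ≼ A ∪ B
  ∪-upperˡ A B = ⊆⇒≼ (Sₚ.p⊆p∪q B)

  ∪-upperʳ : ∀ (A B : Subset n) → B ≼ A ∪ B
  ∪-upperʳ A B = ⊆⇒≼ (Sₚ.q⊆p∪q A B)

  ∩-lowerˡ : ∀ (A B : Subset n) → A ∩ B ≼ A
  ∩-lowerˡ A B = ⊆⇒≼ (Sₚ.p∩q⊆p A B)

  ∩-lowerʳ : ∀ (A B : Subset n) → A ∩ B ≼ B
  ∩-lowerʳ A B = ⊆⇒≼ (Sₚ.p∩q⊆q A B)

  ∪-least : {A B C : Subset n} → A ≼ C → B ≼ C → A ∪ B ≼ C
  ∪-least {A} {B} {C} f g = incl pointwise
    where
    pointwise : ∀ i → lookup (A ∪ B) i ≡ true → lookup C i ≡ true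
    pointwise i e with lookup A i in a | lookup B i in b
    ... | true  | _     = at f i a
    ... | false | true  = at g i b
    ... | false | false = true≢false e (trans (lookup-∪ A B i) (cong₂ _∨_ a b))

  ∩-greatest : {A B C : Subset n} → C ≼ A → C ≼ B → C ≼ A ∩ B
  ∩-greatest {A} {B} f g = incl λ i e → trans (lookup-∩ A B i) (∧-intro (at f i e) (at g i e))

  ⊤-greatest : (A : Subset n) → A ≼ ⊤
  ⊤-greatest A = ⊆⇒≼ Sₚ.⊆⊤

  ∪-absorb : {A B : Subset n} → B ≼ A → A ∪ B ≡ A
  ∪-absorb {A} {B} h = ≼-antisym (∪-least (≼-refl A) h) (∪-upperˡ A B)

  ∩-absorb : {A B : Subset n} → A ≼ B → A ∩ B ≡ A
  ∩-absorb {A} {B} h = ≼-antisym (∩-lowerˡ A B) (∩-greatest (≼-refl A) h)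

  ⁅⁆-≼ : ∀ {A : Subset n} {i} → lookup A i ≡ true → ⁅ i ⁆ ≼ A
  ⁅⁆-≼ {A} {i} h = incl λ j e →
    subst (λ x → lookup A x ≡ true) (sym (Sₚ.x∈⁅y⁆⇒x≡y i (Vₚ.lookup⇒[]= j ⁅ i ⁆ e))) h

  ∉⊥ : ∀ (i : Fin n) → lookup ⊥ i ≡ false
  ∉⊥ i = Vₚ.lookup-replicate i false

  ⁅⁆-∩-⊥ : ∀ {A : Subset n} {i} → lookup A i ≡ false → ⁅ i ⁆ ∩ A ≡ ⊥
  ⁅⁆-∩-⊥ {A} {i} h = ≼-antisym
    (incl λ j e → true≢false
      (trans (sym (cong (lookup A) (same j (at (∩-lowerˡ ⁅ i ⁆ A) j e)))) (at (∩-lowerʳ ⁅ i ⁆ A) j e)) h)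
    (incl λ j e → true≢false e (∉⊥ j))
    where
    same : ∀ j → lookup ⁅ i ⁆ j ≡ true → j ≡ i
    same j e = Sₚ.x∈⁅y⁆⇒x≡y i (Vₚ.lookup⇒[]= j ⁅ i ⁆ e)

  ∈-∪∁ : ∀ {A G : Subset n} {i} → lookup G i ≡ true → lookup (A ∪ ∁ G) i ≡ lookup A i
  ∈-∪∁ {A} {G} {i} h = begin
    lookup (A ∪ ∁ G) i            ≡⟨ lookup-∪ A (∁ G) i ⟩
    lookup A i ∨ lookup (∁ G) i   ≡⟨ cong (lookup A i ∨_) (lookup-∁ G i) ⟩
    lookup A i ∨ not (lookup G i) ≡⟨ cong (λ b → lookup A i ∨ not b) h ⟩
    lookup A i ∨ false            ≡⟨ ∨-identityʳ _ ⟩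
    lookup A i                    ∎
    where open ≡-Reasoning

  ∉-∪∁ : ∀ {A G : Subset n} {i} → lookup G i ≡ false → lookup (A ∪ ∁ G) i ≡ true
  ∉-∪∁ {A} {G} {i} h = at (∪-upperʳ A (∁ G)) i (trans (lookup-∁ G i) (cong not h))

  -- Intersecting with `G` is what the rank function of `restrict M G` does to its argument, so the
  -- loops adjoined to a flat leave no trace in its rank.
  ∪∁-∩ : ∀ {A G : Subset n} → A ≼ G → (A ∪ ∁ G) ∩ G ≡ A
  ∪∁-∩ {A} {G} A≼G = subset-ext λ i → trans (lookup-∩ (A ∪ ∁ G) G i) (pointwise i)
    where
    pointwise : ∀ i → lookup (A ∪ ∁ G) i ∧ lookup G i ≡ lookup A i
    pointwise i with lookup G i in g | lookup A i in a
    ... | true  | b     = trans (∧-identityʳ _) (trans (∈-∪∁ {A} {G} g) a)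
    ... | false | true  = true≢false (at A≼G i a) g
    ... | false | false = ∧-zeroʳ _

  all-sound : ∀ (p : Fin n → Bool) → all p (allFin n) ≡ true → ∀ i → p i ≡ true
  all-sound p h i = go (allFin n) h (∈-allFin i)
    where
    go : ∀ xs → all p xs ≡ true → i ∈ˡ xs → p i ≡ true
    go (x ∷ xs) e (here refl) = ∧-elimˡ e
    go (x ∷ xs) e (there i∈)  = go xs (∧-elimʳ {p x} e) i∈

  all-complete : ∀ (p : Fin n → Bool) → (∀ i → p i ≡ true) → all p (allFin n) ≡ true
  all-complete p h = go (allFin n)
    where
    go : ∀ xs → all p xs ≡ true
    go []       = refl
    go (x ∷ xs) = ∧-intro (h x) (go xs)

  ⊆ᵇ⇒≼ : ∀ (A B : Subset n) → A ⊆ᵇ B ≡ true → A ≼ B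
  ⊆ᵇ⇒≼ A B h = incl λ i e →
    subst (λ a → not a ∨ lookup B i ≡ true) e (all-sound (λ i → not (lookup A i) ∨ lookup B i) h i)

  ≼⇒⊆ᵇ : ∀ {A B : Subset n} → A ≼ B → A ⊆ᵇ B ≡ true
  ≼⇒⊆ᵇ {A} {B} h = all-complete (λ i → not (lookup A i) ∨ lookup B i) pointwise
    where
    pointwise : ∀ i → not (lookup A i) ∨ lookup B i ≡ true
    pointwise i with lookup A i in a
    ... | true  = at h i a
    ... | false = refl

  ≟ᵇ⇒≡ : ∀ (A B : Subset n) → A ≟ᵇ B ≡ true → A ≡ B
  ≟ᵇ⇒≡ A B h = ≼-antisym (⊆ᵇ⇒≼ A B (∧-elimˡ h)) (⊆ᵇ⇒≼ B A (∧-elimʳ {A ⊆ᵇ B} h))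

  ≟ᵇ-refl : ∀ (A : Subset n) → A ≟ᵇ A ≡ true
  ≟ᵇ-refl A = ∧-intro (≼⇒⊆ᵇ (≼-refl A)) (≼⇒⊆ᵇ (≼-refl A))

  ≢⇒≟ᵇ : ∀ {A B : Subset n} → A ≢ B → A ≟ᵇ B ≡ false
  ≢⇒≟ᵇ {A} {B} A≢B = ≢true⇒false (λ e → A≢B (≟ᵇ⇒≡ A B e))

  -- Cardinality is the measure both for the fuel of `mobiusF` and for the induction that inverts a
  -- triangular matrix.
  ≼∧≢⇒∣∣< : ∀ {A B : Subset n} → A ≼ B → A ≢ B → ∣ A ∣ < ∣ B ∣
  ≼∧≢⇒∣∣< {A} {B} A≼B A≢B with ∣ A ∣ ℕₚ.<? ∣ B ∣
  ... | yes lt = lt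
  ... | no ¬lt = ⊥-elim (A≢B (≼-antisym A≼B (incl covers)))
    where
    covers : ∀ i → lookup B i ≡ true → lookup A i ≡ true
    covers i i∈B with lookup A i in a
    ... | true  = refl
    ... | false = ⊥-elim (¬lt (Sₚ.p⊂q⇒∣p∣<∣q∣
      (≼⇒⊆ A≼B , i , Vₚ.lookup⇒[]= i B i∈B ,
       λ i∈A → true≢false (Vₚ.[]=⇒lookup {xs = A} i∈A) a)))

-- Sums over all subsets

∑ˢ : ∀ {n} → (Subset n → ℤ) → ℤ
∑ˢ {n} = ∑ (allSubsets n)

∑ˢ-suc : ∀ {n} (f : Subset (suc n) → ℤ) →
         ∑ˢ f ≡ ∑ˢ (λ A → f (inside ∷ A)) +ℤ ∑ˢ (λ A → f (outside ∷ A))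
∑ˢ-suc {n} f = trans
  (∑-++ (map (inside ∷_) (allSubsets n)) (map (outside ∷_) (allSubsets n)) f)
  (cong₂ _+ℤ_ (∑-map (inside ∷_) (allSubsets n) f) (∑-map (outside ∷_) (allSubsets n) f))

∑ˢ-single : ∀ {n} (B : Subset n) f → (∀ A → A ≢ B → f A ≡ 0ℤ) → ∑ˢ f ≡ f B
∑ˢ-single []            f h = ℤₚ.+-identityʳ (f [])
∑ˢ-single {suc n} (true ∷ B)  f h = trans (∑ˢ-suc f) (trans
  (cong₂ _+ℤ_ (∑ˢ-single B (λ A → f (inside ∷ A)) (λ A A≢B → h _ (A≢B ∘ Vₚ.∷-injectiveʳ)))
              (∑-zero (allSubsets n) (λ A → h (outside ∷ A) (λ ()))))
  (ℤₚ.+-identityʳ _))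
∑ˢ-single {suc n} (false ∷ B) f h = trans (∑ˢ-suc f) (trans
  (cong₂ _+ℤ_ (∑-zero (allSubsets n) (λ A → h (inside ∷ A) (λ ())))
              (∑ˢ-single B (λ A → f (outside ∷ A)) (λ A A≢B → h _ (A≢B ∘ Vₚ.∷-injectiveʳ))))
  (ℤₚ.+-identityˡ _))

_≟ˢ_ : ∀ {n} (A B : Subset n) → Dec (A ≡ B)
_≟ˢ_ = Vₚ.≡-dec _≟_

∑ˢ-split : ∀ {n} (B : Subset n) f → ∑ˢ f ≡ f B +ℤ ∑ˢ (λ A → not (does (A ≟ˢ B)) ▷ f A)
∑ˢ-split {n} B f = begin
  ∑ˢ f
    ≡⟨ ∑-cong (allSubsets n) (λ A → split (does (A ≟ˢ B)) (f A)) ⟩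
  ∑ˢ (λ A → does (A ≟ˢ B) ▷ f A +ℤ not (does (A ≟ˢ B)) ▷ f A)
    ≡⟨ ∑-+ (allSubsets n) (λ A → does (A ≟ˢ B) ▷ f A) (λ A → not (does (A ≟ˢ B)) ▷ f A) ⟩
  ∑ˢ (λ A → does (A ≟ˢ B) ▷ f A) +ℤ ∑ˢ (λ A → not (does (A ≟ˢ B)) ▷ f A)
    ≡⟨ cong (_+ℤ ∑ˢ (λ A → not (does (A ≟ˢ B)) ▷ f A)) (trans
         (∑ˢ-single B (λ A → does (A ≟ˢ B) ▷ f A)
           (λ A A≢B → cong (_▷ f A) (dec-false (A ≟ˢ B) A≢B)))
         (cong (_▷ f B) (dec-true (B ≟ˢ B) refl))) ⟩
  f B +ℤ ∑ˢ (λ A → not (does (A ≟ˢ B)) ▷ f A) ∎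
  where
  open ≡-Reasoning
  split : ∀ b v → v ≡ b ▷ v +ℤ not b ▷ v
  split true  v = sym (ℤₚ.+-identityʳ v)
  split false v = sym (ℤₚ.+-identityˡ v)

∑ˢ-pair : ∀ {n} (B C : Subset n) f → B ≢ C → (∀ A → A ≢ B → A ≢ C → f A ≡ 0ℤ) →
          ∑ˢ f ≡ f B +ℤ f C
∑ˢ-pair B C f B≢C h = trans (∑ˢ-split B f) (cong (f B +ℤ_) (trans
  (∑ˢ-single C (λ A → not (does (A ≟ˢ B)) ▷ f A) elsewhere)
  (cong (λ b → not b ▷ f C) (dec-false (C ≟ˢ B) (B≢C ∘ sym)))))
  where
  elsewhere : ∀ A → A ≢ C → not (does (A ≟ˢ B)) ▷ f A ≡ 0ℤ
  elsewhere A A≢C with A ≟ˢ B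
  ... | yes _  = refl
  ... | no A≢B = h A A≢B A≢C

-- Back substitution in a triangular system: the diagonal entry is isolated once the other entries
-- are known by induction.
∑ˢ-cancel : ∀ {n} (B : Subset n) f g → ∑ˢ f ≡ ∑ˢ g → (∀ A → A ≢ B → f A ≡ g A) → f B ≡ g B
∑ˢ-cancel {n} B f g e h = ∙-cancelʳ ℤₚ.+-0-abelianGroup (rest g) (f B) (g B) (begin
  f B +ℤ rest g ≡⟨ cong (f B +ℤ_) (∑-cong (allSubsets n) same) ⟨
  f B +ℤ rest f ≡⟨ ∑ˢ-split B f ⟨
  ∑ˢ f          ≡⟨ e ⟩
  ∑ˢ g          ≡⟨ ∑ˢ-split B g ⟩
  g B +ℤ rest g ∎)
  where
  open ≡-Reasoning
  rest : (Subset n → ℤ) → ℤ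
  rest u = ∑ˢ (λ A → not (does (A ≟ˢ B)) ▷ u A)
  same : ∀ A → not (does (A ≟ˢ B)) ▷ f A ≡ not (does (A ≟ˢ B)) ▷ g A
  same A with A ≟ˢ B
  ... | yes _  = refl
  ... | no A≢B = h A A≢B

-- The sets containing ∁ G are the sets A ∪ ∁ G for A ⊆ G.
∑ˢ-∪∁ : ∀ {n} (G : Subset n) f g →
        (∀ K i → lookup G i ≡ false → lookup K i ≡ false → f K ≡ 0ℤ) →
        (∀ A i → lookup G i ≡ false → lookup A i ≡ true → g A ≡ 0ℤ) →
        (∀ A → A ≼ G → f (A ∪ ∁ G) ≡ g A) →
        ∑ˢ f ≡ ∑ˢ g
∑ˢ-∪∁ [] f g hf hg e = cong (_+ℤ 0ℤ) (e [] (incl λ ()))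
∑ˢ-∪∁ (true ∷ G) f g hf hg e = trans (∑ˢ-suc f) (trans
  (cong₂ _+ℤ_
    (∑ˢ-∪∁ G (f ∘ (true ∷_)) (g ∘ (true ∷_)) (λ K i → hf (true ∷ K) (suc i)) (λ A i → hg (true ∷ A) (suc i))
       (λ A h → e (true ∷ A) (incl λ { zero _ → refl ; (suc i) → at h i })))
    (∑ˢ-∪∁ G (f ∘ (false ∷_)) (g ∘ (false ∷_)) (λ K i → hf (false ∷ K) (suc i)) (λ A i → hg (false ∷ A) (suc i))
       (λ A h → e (false ∷ A) (incl λ { zero _ → refl ; (suc i) → at h i }))))
  (sym (∑ˢ-suc g)))
∑ˢ-∪∁ {suc n} (false ∷ G) f g hf hg e = begin
  ∑ˢ f                                              ≡⟨ ∑ˢ-suc f ⟩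
  ∑ˢ (f ∘ (true ∷_)) +ℤ ∑ˢ (f ∘ (false ∷_))
    ≡⟨ cong₂ _+ℤ_
         (∑ˢ-∪∁ G (f ∘ (true ∷_)) (g ∘ (false ∷_)) (λ K i → hf (true ∷ K) (suc i)) (λ A i → hg (false ∷ A) (suc i))
            (λ A h → e (false ∷ A) (incl λ { zero () ; (suc i) → at h i })))
         (∑-zero (allSubsets n) (λ K → hf (false ∷ K) zero refl refl)) ⟩
  ∑ˢ (g ∘ (false ∷_)) +ℤ 0ℤ                         ≡⟨ ℤₚ.+-comm (∑ˢ (g ∘ (false ∷_))) 0ℤ ⟩
  0ℤ +ℤ ∑ˢ (g ∘ (false ∷_))
    ≡⟨ cong (_+ℤ ∑ˢ (g ∘ (false ∷_))) (∑-zero (allSubsets n) (λ A → hg (true ∷ A) zero refl refl)) ⟨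
  ∑ˢ (g ∘ (true ∷_)) +ℤ ∑ˢ (g ∘ (false ∷_))         ≡⟨ ∑ˢ-suc g ⟨
  ∑ˢ g                                              ∎
  where open ≡-Reasoning

-- Minors of matroids

Flat : (M : RankFn) → Subset (n M) → Set
Flat M F = ∀ i → lookup F i ≡ false → rk M F < rk M (F ∪ ⁅ i ⁆)

isFlat⇒Flat : ∀ M F → isFlat M F ≡ true → Flat M F
isFlat⇒Flat M F h i i∉F = ℕₚ.<ᵇ⇒< _ _ (true⇒T
  (subst (λ b → b ∨ (rk M F <ᵇ rk M (F ∪ ⁅ i ⁆)) ≡ true) i∉F (all-sound _ h i)))

Flat⇒isFlat : ∀ M F → Flat M F → isFlat M F ≡ true
Flat⇒isFlat M F h = all-complete _ pointwise
  where
  pointwise : ∀ i → lookup F i ∨ (rk M F <ᵇ rk M (F ∪ ⁅ i ⁆)) ≡ true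
  pointwise i with lookup F i in i∈F
  ... | true  = refl
  ... | false = T⇒true (ℕₚ.<⇒<ᵇ (h i i∈F))

rk-mono : ∀ {M} → IsMatroid M → ∀ {A B} → A ≼ B → rk M A ≤ rk M B
rk-mono mat A≼B = R2 mat _ _ (≼⇒⊆ A≼B)

restrict-isMatroid : ∀ {M} → IsMatroid M → ∀ F → IsMatroid (restrict M F)
restrict-isMatroid {M} mat F = record
  { R1 = λ A → ℕₚ.≤-trans (R1 mat (A ∩ F)) (Sₚ.∣p∩q∣≤∣p∣ A F)
  ; R2 = λ A B A⊆B → rk-mono mat (∩-greatest (≼-trans (∩-lowerˡ A F) (⊆⇒≼ A⊆B)) (∩-lowerʳ A F))
  ; R3 = λ A B → ℕₚ.≤-trans
      (ℕₚ.+-mono-≤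
        (ℕₚ.≤-reflexive (cong (rk M) (Sₚ.∩-distribʳ-∪ F A B)))
        (rk-mono mat (∩-greatest
          (∩-greatest (≼-trans (∩-lowerˡ (A ∩ B) F) (∩-lowerˡ A B)) (∩-lowerʳ (A ∩ B) F))
          (∩-greatest (≼-trans (∩-lowerˡ (A ∩ B) F) (∩-lowerʳ A B)) (∩-lowerʳ (A ∩ B) F)))))
      (R3 mat (A ∩ F) (B ∩ F))
  }

contract-isMatroid : ∀ {M} → IsMatroid M → ∀ F → IsMatroid (contract M F)
contract-isMatroid {M} mat F = record
  { R1 = λ A → ℕₚ.m≤n+o⇒m∸n≤o (rk M (A ∪ F)) (rk M F) (begin
      rk M (A ∪ F)                 ≤⟨ ℕₚ.m≤m+n _ _ ⟩
      rk M (A ∪ F) + rk M (A ∩ F)  ≤⟨ R3 mat A F ⟩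
      rk M A + rk M F              ≤⟨ ℕₚ.+-monoˡ-≤ (rk M F) (R1 mat A) ⟩
      ∣ A ∣ + rk M F               ≡⟨ ℕₚ.+-comm ∣ A ∣ (rk M F) ⟩
      rk M F + ∣ A ∣               ∎)
  ; R2 = λ A B A⊆B → ℕₚ.∸-monoˡ-≤ (rk M F)
      (rk-mono mat (∪-least (≼-trans (⊆⇒≼ A⊆B) (∪-upperˡ B F)) (∪-upperʳ B F)))
  ; R3 = λ A B → ∸-submodular (above (A ∪ B)) (above (A ∩ B)) (above A) (above B) (ℕₚ.≤-trans
      (ℕₚ.+-mono-≤
        (rk-mono mat (∪-least
          (∪-least (≼-trans (∪-upperˡ A F) (∪-upperˡ (A ∪ F) (B ∪ F)))
                   (≼-trans (∪-upperˡ B F) (∪-upperʳ (A ∪ F) (B ∪ F))))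
          (≼-trans (∪-upperʳ A F) (∪-upperˡ (A ∪ F) (B ∪ F)))))
        (rk-mono mat (∩-greatest
          (∪-least (≼-trans (∩-lowerˡ A B) (∪-upperˡ A F)) (∪-upperʳ A F))
          (∪-least (≼-trans (∩-lowerʳ A B) (∪-upperˡ B F)) (∪-upperʳ B F)))))
      (R3 mat (A ∪ F) (B ∪ F)))
  }
  where
  open ℕₚ.≤-Reasoning
  above : ∀ A → rk M F ≤ rk M (A ∪ F)
  above A = rk-mono mat (∪-upperʳ A F)
  shift : ∀ f a b → (f + a) + (f + b) ≡ (f + f) + (a + b)
  shift = solveℕ
  -- All four ranks are at least `f`. Written as `f` plus an excess, the truncated subtractions
  -- disappear and `f + f` cancels.
  ∸-submodular : ∀ {f a b c d} → f ≤ a → f ≤ b → f ≤ c → f ≤ d → a + b ≤ c + d →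
                 (a ∸ f) + (b ∸ f) ≤ (c ∸ f) + (d ∸ f)
  ∸-submodular {f} f≤a f≤b f≤c f≤d h
    with ℕₚ.m≤n⇒∃[o]m+o≡n f≤a | ℕₚ.m≤n⇒∃[o]m+o≡n f≤b | ℕₚ.m≤n⇒∃[o]m+o≡n f≤c | ℕₚ.m≤n⇒∃[o]m+o≡n f≤d
  ... | a , refl | b , refl | c , refl | d , refl
    rewrite ℕₚ.m+n∸m≡n f a | ℕₚ.m+n∸m≡n f b | ℕₚ.m+n∸m≡n f c | ℕₚ.m+n∸m≡n f d =
    ℕₚ.+-cancelˡ-≤ (f + f) (a + b) (c + d) (subst₂ _≤_ (shift f a b) (shift f c d) h)

rk-contract : ∀ M {F K} → F ≼ K → rk (contract M F) K ≡ rk M K ∸ rk M F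
rk-contract M {F} F≼K = cong (λ A → rk M A ∸ rk M F) (∪-absorb F≼K)

rank-contract : ∀ M F → rank (contract M F) ≡ rank M ∸ rk M F
rank-contract M F = rk-contract M (⊤-greatest F)

rank-restrict : ∀ M G → rank (restrict M G) ≡ rk M G
rank-restrict M G = cong (rk M) (Sₚ.∩-identityˡ G)

rk-restrict : ∀ M {A G} → A ≼ G → rk (restrict M G) (A ∪ ∁ G) ≡ rk M A
rk-restrict M A≼G = cong (rk M) (∪∁-∩ A≼G)

-- The elements of `F` are loops of the contraction, so its flats contain them. On sets above `F`
-- the two rank functions differ by the constant `rk M F`, so the same added elements raise both.
isFlat-contract : ∀ {M} → IsMatroid M → ∀ F K →
                  isFlat (contract M F) K ≡ isFlat M K ∧ (F ⊆ᵇ K)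
isFlat-contract {M} mat F K = Bool-ext
  (λ e → let h = isFlat⇒Flat (contract M F) K e in
     ∧-intro (Flat⇒isFlat M K (down (contains h) h)) (≼⇒⊆ᵇ (contains h)))
  (λ e → Flat⇒isFlat (contract M F) K
     (up (⊆ᵇ⇒≼ F K (∧-elimʳ {isFlat M K} e)) (isFlat⇒Flat M K (∧-elimˡ e))))
  where
  contains : Flat (contract M F) K → F ≼ K
  contains h = incl contains′
    where
    contains′ : ∀ i → lookup F i ≡ true → lookup K i ≡ true
    contains′ i i∈F with lookup K i in i∈K
    ... | true  = refl
    ... | false = ⊥-elim (ℕₚ.<⇒≱ (h i i∈K) (ℕₚ.∸-monoˡ-≤ (rk M F) (rk-mono mat
      (∪-least (∪-least (∪-upperˡ K F) (≼-trans (⁅⁆-≼ i∈F) (∪-upperʳ K F))) (∪-upperʳ K F)))))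
  down : F ≼ K → Flat (contract M F) K → Flat M K
  down F≼K h i i∉K = ℕₚ.≰⇒> λ ge → ℕₚ.<⇒≱
    (subst₂ _<_ (rk-contract M F≼K) (rk-contract M (≼-trans F≼K (∪-upperˡ K ⁅ i ⁆))) (h i i∉K))
    (ℕₚ.∸-monoˡ-≤ (rk M F) ge)
  up : F ≼ K → Flat M K → Flat (contract M F) K
  up F≼K h i i∉K = subst₂ _<_
    (sym (rk-contract M F≼K)) (sym (rk-contract M (≼-trans F≼K (∪-upperˡ K ⁅ i ⁆))))
    (ℕₚ.∸-monoˡ-< (h i i∉K) (rk-mono mat F≼K))

restrict-∪∁-∪ : ∀ {n} {A G : Subset n} {i} → A ≼ G → lookup G i ≡ true →
                ((A ∪ ∁ G) ∪ ⁅ i ⁆) ∩ G ≡ A ∪ ⁅ i ⁆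
restrict-∪∁-∪ {A = A} {G} {i} A≼G i∈G = trans (Sₚ.∩-distribʳ-∪ G (A ∪ ∁ G) ⁅ i ⁆)
  (cong₂ _∪_ (∪∁-∩ A≼G) (∩-absorb (⁅⁆-≼ i∈G)))

-- For `i` in `G` the two tests coincide. For `i` outside `G` the restriction tests nothing, and
-- that `i` raises the rank of `A` follows by submodularity from its raising the rank of the flat
-- `G`.
isFlat-restrict : ∀ {M} → IsMatroid M → ∀ {A G} → Flat M G → A ≼ G →
                  isFlat (restrict M G) (A ∪ ∁ G) ≡ isFlat M A
isFlat-restrict {M} mat {A} {G} flatG A≼G = Bool-ext
  (λ e → Flat⇒isFlat M A (λ i → extend (isFlat⇒Flat (restrict M G) (A ∪ ∁ G) e) i (lookup G i) refl))
  (λ e → Flat⇒isFlat (restrict M G) (A ∪ ∁ G) (λ i → descend (isFlat⇒Flat M A e) i (lookup G i) refl))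
  where
  extend : Flat (restrict M G) (A ∪ ∁ G) → ∀ i b → lookup G i ≡ b → lookup A i ≡ false → rk M A < rk M (A ∪ ⁅ i ⁆)
  extend h i true i∈G i∉A = subst₂ _<_ (cong (rk M) (∪∁-∩ A≼G)) (cong (rk M) (restrict-∪∁-∪ A≼G i∈G))
    (h i (trans (∈-∪∁ {A = A} {G} i∈G) i∉A))
  extend h i false i∉G i∉A = ℕₚ.+-cancelʳ-< (rk M G) (rk M A) (rk M (A ∪ ⁅ i ⁆)) (begin-strict
    rk M A + rk M G                                    <⟨ ℕₚ.+-monoʳ-< (rk M A) (flatG i i∉G) ⟩
    rk M A + rk M (G ∪ ⁅ i ⁆)                          ≡⟨ ℕₚ.+-comm (rk M A) _ ⟩
    rk M (G ∪ ⁅ i ⁆) + rk M A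
      ≤⟨ ℕₚ.+-mono-≤
           (rk-mono mat (∪-least (∪-upperʳ (A ∪ ⁅ i ⁆) G) (≼-trans (∪-upperʳ A ⁅ i ⁆) (∪-upperˡ (A ∪ ⁅ i ⁆) G))))
           (rk-mono mat (∩-greatest (∪-upperˡ A ⁅ i ⁆) A≼G)) ⟩
    rk M ((A ∪ ⁅ i ⁆) ∪ G) + rk M ((A ∪ ⁅ i ⁆) ∩ G)    ≤⟨ R3 mat (A ∪ ⁅ i ⁆) G ⟩
    rk M (A ∪ ⁅ i ⁆) + rk M G                          ∎)
    where open ℕₚ.≤-Reasoning
  descend : Flat M A → ∀ i b → lookup G i ≡ b → lookup (A ∪ ∁ G) i ≡ false →
            rk (restrict M G) (A ∪ ∁ G) < rk (restrict M G) ((A ∪ ∁ G) ∪ ⁅ i ⁆)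
  descend h i true i∈G i∉ = subst₂ _<_ (sym (cong (rk M) (∪∁-∩ A≼G))) (sym (cong (rk M) (restrict-∪∁-∪ A≼G i∈G)))
    (h i (trans (sym (∈-∪∁ {A = A} {G} i∈G)) i∉))
  descend h i false i∉G i∉ = true≢false (∉-∪∁ {A = A} {G} i∉G) i∉

∪-⁅⁆-∩ : ∀ {n} {A G : Subset n} {i} → lookup G i ≡ false → (A ∪ ⁅ i ⁆) ∩ G ≡ A ∩ G
∪-⁅⁆-∩ {A = A} {G} {i} i∉G = trans (Sₚ.∩-distribʳ-∪ G A ⁅ i ⁆)
  (trans (cong ((A ∩ G) ∪_) (⁅⁆-∩-⊥ i∉G)) (Sₚ.∪-identityʳ (A ∩ G)))

isFlat-restrict-loop : ∀ M {G K i} → lookup G i ≡ false → lookup K i ≡ false →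
                       isFlat (restrict M G) K ≡ false
isFlat-restrict-loop M {G} {K} {i} i∉G i∉K = ≢true⇒false λ e →
  ℕₚ.<-irrefl (cong (rk M) (sym (∪-⁅⁆-∩ {A = K} i∉G))) (isFlat⇒Flat (restrict M G) K e i i∉K)

-- Flats and Möbius functions of minors

▷-comm : ∀ a b {v} → a ▷ b ▷ v ≡ b ▷ a ▷ v
▷-comm true  b     = refl
▷-comm false true  = refl
▷-comm false false = refl

∑-flats : ∀ M f → ∑ (flats M) f ≡ ∑ˢ (λ A → isFlat M A ▷ f A)
∑-flats M f = ∑-filter (allSubsets (n M)) (isFlat M) f

below : ∀ {n} → Subset n → Subset n → Subset n → Bool
below x y z = (x ⊆ᵇ z) ∧ (z ⊆ᵇ y) ∧ not (z ≟ᵇ y)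

∑-below : ∀ M x y f → ∑ (filterᵇ (below x y) (flats M)) f ≡ ∑ˢ (λ z → below x y z ▷ isFlat M z ▷ f z)
∑-below M x y f = trans (∑-filter (flats M) (below x y) f)
  (trans (∑-flats M (λ z → below x y z ▷ f z))
         (∑-cong (allSubsets (n M)) (λ z → ▷-comm (isFlat M z) (below x y z))))

-- One unfolding of `mobiusF` with its tests and its recursive sum abstracted. The agreement is
-- definitional, so `cong` can rewrite under the recursion.
mobius-step : Bool → Bool → ℤ → ℤ
mobius-step eq le s = if eq then 1ℤ else if le then -ℤ s else 0ℤ

-- The recursion visits only flats above `x`, hence above `F`, where contraction does not affect
-- flatness. The ground set is unchanged, so the fuel is the same on both sides.
mobiusF-contract : ∀ {M} → IsMatroid M → ∀ F k x y → F ≼ x →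
                   mobiusF (contract M F) k x y ≡ mobiusF M k x y
mobiusF-contract {M} mat F zero    x y F≼x = refl
mobiusF-contract {M} mat F (suc k) x y F≼x = cong (mobius-step (x ≟ᵇ y) (x ⊆ᵇ y)) (begin
  ∑ (filterᵇ (below x y) (flats (contract M F))) (mobiusF (contract M F) k x)
    ≡⟨ ∑-below (contract M F) x y _ ⟩
  ∑ˢ (λ z → below x y z ▷ isFlat (contract M F) z ▷ mobiusF (contract M F) k x z)
    ≡⟨ ∑-cong (allSubsets (n M)) (λ z → ▷-congʳ (below x y z) (λ e →
         cong₂ _▷_ (flat≡ z (≼-trans F≼x (⊆ᵇ⇒≼ x z (∧-elimˡ e)))) (mobiusF-contract mat F k x z F≼x))) ⟩
  ∑ˢ (λ z → below x y z ▷ isFlat M z ▷ mobiusF M k x z)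
    ≡⟨ ∑-below M x y _ ⟨
  ∑ (filterᵇ (below x y) (flats M)) (mobiusF M k x) ∎)
  where
  open ≡-Reasoning
  flat≡ : ∀ z → F ≼ z → isFlat (contract M F) z ≡ isFlat M z
  flat≡ z F≼z = trans (isFlat-contract mat F z)
    (trans (cong (isFlat M z ∧_) (≼⇒⊆ᵇ F≼z)) (∧-identityʳ _))

⊆ᵇ-∪∁ : ∀ {n} {x y G : Subset n} → x ≼ G → (x ∪ ∁ G) ⊆ᵇ (y ∪ ∁ G) ≡ x ⊆ᵇ y
⊆ᵇ-∪∁ {x = x} {y} {G} x≼G = Bool-ext
  (λ e → ≼⇒⊆ᵇ {A = x} {y} (incl λ i i∈x → trans (sym (∈-∪∁ {A = y} {G} (at x≼G i i∈x)))
     (at (⊆ᵇ⇒≼ (x ∪ ∁ G) (y ∪ ∁ G) e) i (at (∪-upperˡ x (∁ G)) i i∈x))))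
  (λ e → ≼⇒⊆ᵇ (∪-least (≼-trans (⊆ᵇ⇒≼ x y e) (∪-upperˡ y (∁ G))) (∪-upperʳ y (∁ G))))

≟ᵇ-∪∁ : ∀ {n} {x y G : Subset n} → x ≼ G → y ≼ G → (x ∪ ∁ G) ≟ᵇ (y ∪ ∁ G) ≡ x ≟ᵇ y
≟ᵇ-∪∁ {x = x} {y} x≼G y≼G = cong₂ _∧_ (⊆ᵇ-∪∁ {x = x} {y} x≼G) (⊆ᵇ-∪∁ {x = y} {x} y≼G)

-- The elements outside G are loops of the restriction, so its flats are the sets A ∪ ∁ G with
-- A ⊆ G a flat of M.
∑-restrict : ∀ {M} → IsMatroid M → ∀ {G} → Flat M G → ∀ (f g : Subset (n M) → ℤ) →
  (∀ A i → lookup G i ≡ false → lookup A i ≡ true → g A ≡ 0ℤ) →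
  (∀ A → A ≼ G → f (A ∪ ∁ G) ≡ g A) →
  ∑ˢ (λ K → isFlat (restrict M G) K ▷ f K) ≡ ∑ˢ (λ A → isFlat M A ▷ g A)
∑-restrict {M} mat {G} flatG f g hg e = ∑ˢ-∪∁ G
  (λ K → isFlat (restrict M G) K ▷ f K) (λ A → isFlat M A ▷ g A)
  (λ K i i∉G i∉K → cong (_▷ f K) (isFlat-restrict-loop M i∉G i∉K))
  (λ A i i∉G i∈A → ▷-zero (isFlat M A) (λ _ → hg A i i∉G i∈A))
  (λ A A≼G → cong₂ _▷_ (isFlat-restrict mat flatG A≼G) (e A A≼G))

⊆ᵇ-outside : ∀ {n} (A G : Subset n) {i} → lookup G i ≡ false → lookup A i ≡ true → A ⊆ᵇ G ≡ false
⊆ᵇ-outside A G i∉G i∈A = ≢true⇒false λ e → true≢false (at (⊆ᵇ⇒≼ A G e) _ i∈A) i∉G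

mobiusF-restrict : ∀ {M} → IsMatroid M → ∀ {G} → Flat M G → ∀ k x y → x ≼ G → y ≼ G →
                   mobiusF (restrict M G) k (x ∪ ∁ G) (y ∪ ∁ G) ≡ mobiusF M k x y
mobiusF-restrict {M} mat {G} flatG zero    x y x≼G y≼G = refl
mobiusF-restrict {M} mat {G} flatG (suc k) x y x≼G y≼G =
  trans (cong₂ (λ a b → mobius-step a b (∑ (filterᵇ (below x′ y′) (flats (restrict M G))) (mobiusF (restrict M G) k x′))) (≟ᵇ-∪∁ {x = x} {y} x≼G y≼G) (⊆ᵇ-∪∁ {x = x} {y} x≼G))
  (cong (mobius-step (x ≟ᵇ y) (x ⊆ᵇ y)) (begin
  ∑ (filterᵇ (below x′ y′) (flats (restrict M G))) (mobiusF (restrict M G) k x′)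
    ≡⟨ ∑-filter (flats (restrict M G)) (below x′ y′) _ ⟩
  ∑ (flats (restrict M G)) (λ z → below x′ y′ z ▷ mobiusF (restrict M G) k x′ z)
    ≡⟨ ∑-flats (restrict M G) _ ⟩
  ∑ˢ (λ z → isFlat (restrict M G) z ▷ below x′ y′ z ▷ mobiusF (restrict M G) k x′ z)
    ≡⟨ ∑-restrict mat flatG _ _
         (λ z i i∉G i∈z → cong (_▷ mobiusF M k x z) (≢true⇒false {below x y z} λ e →
            true≢false (at y≼G i (at (⊆ᵇ⇒≼ z y (∧-elimˡ {z ⊆ᵇ y} (∧-elimʳ {x ⊆ᵇ z} e))) i i∈z)) i∉G))
         (λ z z≼G → cong₂ _▷_
            (cong₂ _∧_ (⊆ᵇ-∪∁ {x = x} {z} x≼G) (cong₂ _∧_ (⊆ᵇ-∪∁ {x = z} {y} z≼G) (cong not (≟ᵇ-∪∁ {x = z} {y} z≼G y≼G))))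
            (mobiusF-restrict mat flatG k x z x≼G z≼G)) ⟩
  ∑ˢ (λ z → isFlat M z ▷ below x y z ▷ mobiusF M k x z)
    ≡⟨ ∑-flats M _ ⟨
  ∑ (flats M) (λ z → below x y z ▷ mobiusF M k x z)
    ≡⟨ ∑-filter (flats M) (below x y) _ ⟨
  ∑ (filterᵇ (below x y) (flats M)) (mobiusF M k x) ∎))
  where
  open ≡-Reasoning
  x′ y′ : Subset (n M)
  x′ = x ∪ ∁ G
  y′ = y ∪ ∁ G

≡ᵇ-false : ∀ {a b} → a ≢ b → (a ≡ᵇ b) ≡ false
≡ᵇ-false {a} {b} a≢b = ≢true⇒false λ e → a≢b (ℕₚ.≡ᵇ⇒≡ a b (true⇒T e))

lookup-bot : ∀ M i → lookup (bot M) i ≡ (rk M (⊥ ∪ ⁅ i ⁆) ≡ᵇ rk M ⊥)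
lookup-bot M i = trans (Vₚ.lookup∘tabulate _ i)
  (cong (_∨ (rk M (⊥ ∪ ⁅ i ⁆) ≡ᵇ rk M ⊥)) (∉⊥ i))

-- The loops of the contraction are the elements that do not raise the rank of `F`; for a flat these
-- are just its own elements.
bot-contract : ∀ {M} → IsMatroid M → ∀ {F} → Flat M F → bot (contract M F) ≡ F
bot-contract {M} mat {F} flatF = subset-ext λ i →
  trans (lookup-bot (contract M F) i) (pointwise i (lookup F i) refl)
  where
  pointwise : ∀ i b → lookup F i ≡ b →
    (rk (contract M F) (⊥ ∪ ⁅ i ⁆) ≡ᵇ rk (contract M F) ⊥) ≡ lookup F i
  pointwise i true i∈F = trans (T⇒true (ℕₚ.≡⇒≡ᵇ _ _ (cong (λ A → rk M A ∸ rk M F)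
    (≼-antisym (∪-least (∪-least (∪-upperˡ ⊥ F) (≼-trans (⁅⁆-≼ i∈F) (∪-upperʳ ⊥ F))) (∪-upperʳ ⊥ F))
               (∪-least (≼-trans (∪-upperˡ ⊥ ⁅ i ⁆) (∪-upperˡ (⊥ ∪ ⁅ i ⁆) F)) (∪-upperʳ (⊥ ∪ ⁅ i ⁆) F)))))) (sym i∈F)
  pointwise i false i∉F = trans (≡ᵇ-false (λ e → ℕₚ.<-irrefl (sym e) strict)) (sym i∉F)
    where
    strict : rk (contract M F) ⊥ < rk (contract M F) (⊥ ∪ ⁅ i ⁆)
    strict = ℕₚ.∸-monoˡ-<
      (subst₂ _<_ (cong (rk M) (sym (Sₚ.∪-identityˡ F)))
                  (cong (rk M) (trans (Sₚ.∪-comm F ⁅ i ⁆) (cong (_∪ F) (sym (Sₚ.∪-identityˡ ⁅ i ⁆)))))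
                  (flatF i i∉F))
      (rk-mono mat (∪-upperʳ ⊥ F))

bot-restrict : ∀ M G → bot (restrict M G) ≡ bot M ∪ ∁ G
bot-restrict M G = subset-ext λ i → trans (lookup-bot (restrict M G) i) (pointwise i (lookup G i) refl)
  where
  pointwise : ∀ i b → lookup G i ≡ b →
    (rk (restrict M G) (⊥ ∪ ⁅ i ⁆) ≡ᵇ rk (restrict M G) ⊥) ≡ lookup (bot M ∪ ∁ G) i
  pointwise i true i∈G = trans
    (cong₂ (λ A B → rk M A ≡ᵇ rk M B)
       (∩-absorb (∪-least (incl λ j e → true≢false e (∉⊥ j)) (⁅⁆-≼ i∈G))) (Sₚ.∩-zeroˡ G))
    (sym (trans (∈-∪∁ {A = bot M} {G} i∈G) (lookup-bot M i)))
  pointwise i false i∉G = trans (T⇒true (ℕₚ.≡⇒≡ᵇ _ _ (cong (rk M) (∪-⁅⁆-∩ {A = ⊥} i∉G))))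
    (sym (∉-∪∁ {A = bot M} {G} i∉G))

-- Characteristic polynomials of minors

charPoly-contract : ∀ {M} → IsMatroid M → ∀ {F} → Flat M F →
  charPoly (contract M F) ≈
    ∑ᴾ (allSubsets (n M)) (λ A → mask (isFlat M A) (mask (F ⊆ᵇ A)
      (mono (mobius M F A) ((rank M ∸ rk M F) ∸ (rk M A ∸ rk M F)))))
charPoly-contract {M} mat {F} flatF j = begin
  charPoly (contract M F) j
    ≡⟨ ∑-flats (contract M F) _ ⟩
  ∑ˢ (λ A → isFlat (contract M F) A ▷
            mono (mobius (contract M F) (bot (contract M F)) A) (rank (contract M F) ∸ rk (contract M F) A) j)
    ≡⟨ ∑-cong (allSubsets (n M)) (λ A → trans
         (▷-cong (isFlat-contract mat F A) (λ e →
            let F≼A = ⊆ᵇ⇒≼ F A (∧-elimʳ {isFlat M A} (trans (sym (isFlat-contract mat F A)) e)) in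
            cong₂ (λ c a → mono c a j)
              (trans (cong (λ B → mobius (contract M F) B A) (bot-contract mat flatF))
                     (mobiusF-contract mat F (suc (n M)) F A (≼-refl F)))
              (cong₂ _∸_ (rank-contract M F) (rk-contract M F≼A))))
         (▷-∧ (isFlat M A) (F ⊆ᵇ A))) ⟩
  ∑ˢ (λ A → isFlat M A ▷ (F ⊆ᵇ A) ▷ mono (mobius M F A) ((rank M ∸ rk M F) ∸ (rk M A ∸ rk M F)) j) ∎
  where open ≡-Reasoning

charPoly-restrict : ∀ {M} → IsMatroid M → ∀ {G} → Flat M G → bot M ≼ G →
  charPoly (restrict M G) ≈
    ∑ᴾ (allSubsets (n M)) (λ A → mask (isFlat M A) (mask (A ⊆ᵇ G)
      (mono (mobius M (bot M) A) (rk M G ∸ rk M A))))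
charPoly-restrict {M} mat {G} flatG bot≼G j = trans (∑-flats (restrict M G) _)
  (∑-restrict mat flatG _ _
    (λ A i i∉G i∈A → cong (_▷ mono (mobius M (bot M) A) (rk M G ∸ rk M A) j) (⊆ᵇ-outside A G i∉G i∈A))
    (λ A A≼G → trans
      (cong₂ (λ c a → mono c a j)
        (trans (cong (λ B → mobius (restrict M G) B (A ∪ ∁ G)) (bot-restrict M G))
               (mobiusF-restrict mat flatG (suc (n M)) (bot M) A bot≼G A≼G))
        (cong₂ _∸_ (rank-restrict M G) (rk-restrict M A≼G)))
      (sym (cong (_▷ mono (mobius M (bot M) A) (rk M G ∸ rk M A) j) (≼⇒⊆ᵇ A≼G)))))

∸-∸-cancel : ∀ {f a g} → f ≤ a → f ≤ g → (g ∸ f) ∸ (a ∸ f) ≡ g ∸ a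
∸-∸-cancel {f} {a} {g} f≤a f≤g = trans (ℕₚ.∸-+-assoc g f (a ∸ f)) (cong (g ∸_) (ℕₚ.m+[n∸m]≡n f≤a))

-- The recursion of `P` in `contract M F` restricts after contracting, that of `Q` in `restrict M G`
-- contracts after restricting. Both minors have the interval from `F` to `G` as lattice of flats;
-- this lemma and `charPoly-lower-interval` bring their characteristic polynomials to one and the
-- same sum over the flats of `M`.
charPoly-upper-interval : ∀ {M} → IsMatroid M → ∀ {F G} → Flat M F → Flat M G → F ≼ G →
  charPoly (restrict (contract M F) G) ≈
    ∑ᴾ (allSubsets (n M)) (λ A → mask (isFlat M A) (mask ((F ⊆ᵇ A) ∧ (A ⊆ᵇ G))
      (mono (mobius M F A) (rk M G ∸ rk M A))))
charPoly-upper-interval {M} mat {F} {G} flatF flatG F≼G j = trans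
  (charPoly-restrict (contract-isMatroid mat F) flatG′ (subst (_≼ G) (sym (bot-contract mat flatF)) F≼G) j)
  (∑-cong (allSubsets (n M)) (λ A → trans
    (▷-cong {u = (A ⊆ᵇ G) ▷ mono (mobius (contract M F) (bot (contract M F)) A)
                       (rk (contract M F) G ∸ rk (contract M F) A) j} (isFlat-contract mat F A) (λ _ → refl))
    (trans (▷-∧ (isFlat M A) (F ⊆ᵇ A)) (▷-congʳ (isFlat M A) λ _ → trans
      (▷-congʳ (F ⊆ᵇ A) λ e → ▷-congʳ (A ⊆ᵇ G) λ _ →
        let F≼A = ⊆ᵇ⇒≼ F A e in
        cong₂ (λ c a → mono c a j)
          (trans (cong (λ B → mobius (contract M F) B A) (bot-contract mat flatF))
                 (mobiusF-contract mat F (suc (n M)) F A (≼-refl F)))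
          (trans (cong₂ _∸_ (rk-contract M F≼G) (rk-contract M F≼A))
                 (∸-∸-cancel (rk-mono mat F≼A) (rk-mono mat F≼G))))
      (sym (▷-∧ (F ⊆ᵇ A) (A ⊆ᵇ G)))))))
  where
  flatG′ : Flat (contract M F) G
  flatG′ = isFlat⇒Flat (contract M F) G
    (trans (isFlat-contract mat F G) (∧-intro (Flat⇒isFlat M G flatG) (≼⇒⊆ᵇ F≼G)))

charPoly-lower-interval : ∀ {M} → IsMatroid M → ∀ {F G} → Flat M F → Flat M G → F ≼ G →
  charPoly (contract (restrict M G) (F ∪ ∁ G)) ≈
    ∑ᴾ (allSubsets (n M)) (λ A → mask (isFlat M A) (mask ((F ⊆ᵇ A) ∧ (A ⊆ᵇ G))
      (mono (mobius M F A) (rk M G ∸ rk M A))))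
charPoly-lower-interval {M} mat {F} {G} flatF flatG F≼G j = trans
  (charPoly-contract (restrict-isMatroid mat G) flatF′ j)
  (∑-restrict mat flatG _ _
    (λ A i i∉G i∈A → cong (_▷ mono (mobius M F A) (rk M G ∸ rk M A) j)
      (trans (cong ((F ⊆ᵇ A) ∧_) (⊆ᵇ-outside A G i∉G i∈A)) (∧-zeroʳ (F ⊆ᵇ A))))
    (λ A A≼G → ▷-cong
      (trans (⊆ᵇ-∪∁ {x = F} {A} F≼G) (sym (trans (cong ((F ⊆ᵇ A) ∧_) (≼⇒⊆ᵇ A≼G)) (∧-identityʳ _))))
      (λ e → let F≼A = ⊆ᵇ⇒≼ F A (trans (sym (⊆ᵇ-∪∁ {x = F} {A} F≼G)) e) in
        cong₂ (λ c a → mono c a j)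
          (mobiusF-restrict mat flatG (suc (n M)) F A F≼G A≼G)
          (trans (cong₂ (λ r f → (r ∸ f) ∸ (rk (restrict M G) (A ∪ ∁ G) ∸ f)) (rank-restrict M G) (rk-restrict M F≼G))
                 (trans (cong (λ a → (rk M G ∸ rk M F) ∸ (a ∸ rk M F)) (rk-restrict M A≼G))
                        (∸-∸-cancel (rk-mono mat F≼A) (rk-mono mat F≼G)))))))
  where
  flatF′ : Flat (restrict M G) (F ∪ ∁ G)
  flatF′ = isFlat⇒Flat (restrict M G) (F ∪ ∁ G)
    (trans (isFlat-restrict mat flatG F≼G) (Flat⇒isFlat M F flatF))

-- Möbius inversion

-- Each recursive call passes to a proper subset of `y`, so any fuel above the cardinality of `y` is
-- never exhausted.
mobiusF-stable : ∀ M k x y → ∣ y ∣ < k → mobiusF M (suc k) x y ≡ mobiusF M k x y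
mobiusF-stable M (suc k) x y (s≤s ∣y∣≤k) = cong (mobius-step (x ≟ᵇ y) (x ⊆ᵇ y)) (begin
  ∑ (filterᵇ (below x y) (flats M)) (mobiusF M (suc k) x)
    ≡⟨ ∑-below M x y _ ⟩
  ∑ˢ (λ z → below x y z ▷ isFlat M z ▷ mobiusF M (suc k) x z)
    ≡⟨ ∑-cong (allSubsets (n M)) (λ z → ▷-congʳ (below x y z) λ e → cong (isFlat M z ▷_)
         (mobiusF-stable M k x z (ℕₚ.<-≤-trans (smaller z e) ∣y∣≤k))) ⟩
  ∑ˢ (λ z → below x y z ▷ isFlat M z ▷ mobiusF M k x z)
    ≡⟨ ∑-below M x y _ ⟨
  ∑ (filterᵇ (below x y) (flats M)) (mobiusF M k x) ∎)
  where
  open ≡-Reasoning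
  smaller : ∀ z → below x y z ≡ true → ∣ z ∣ < ∣ y ∣
  smaller z e = ≼∧≢⇒∣∣< (⊆ᵇ⇒≼ z y (∧-elimˡ {z ⊆ᵇ y} z<y))
    (λ { refl → true≢false (∧-elimʳ {z ⊆ᵇ y} z<y) (cong not (≟ᵇ-refl z)) })
    where
    z<y : (z ⊆ᵇ y) ∧ not (z ≟ᵇ y) ≡ true
    z<y = ∧-elimʳ {x ⊆ᵇ z} e

mobius-refl : ∀ M x → mobius M x x ≡ 1ℤ
mobius-refl M x = cong (λ b → mobius-step b (x ⊆ᵇ x) (∑ (filterᵇ (below x x) (flats M)) (mobiusF M (n M) x))) (≟ᵇ-refl x)

-- Unfolding `mobius` directly leaves a smaller fuel inside the sum. One extra unit, added first by
-- `mobiusF-stable`, gives a recursion in `mobius` itself.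
mobius-rec : ∀ M {x y} → x ≼ y → x ≢ y →
             mobius M x y ≡ -ℤ ∑ˢ (λ z → below x y z ▷ isFlat M z ▷ mobius M x z)
mobius-rec M {x} {y} x≼y x≢y = begin
  mobius M x y
    ≡⟨ mobiusF-stable M (suc (n M)) x y (s≤s (Sₚ.∣p∣≤n y)) ⟨
  mobius-step (x ≟ᵇ y) (x ⊆ᵇ y) (∑ (filterᵇ (below x y) (flats M)) (mobius M x))
    ≡⟨ cong₂ (λ a b → mobius-step a b (∑ (filterᵇ (below x y) (flats M)) (mobius M x))) (≢⇒≟ᵇ x≢y) (≼⇒⊆ᵇ x≼y) ⟩
  -ℤ ∑ (filterᵇ (below x y) (flats M)) (mobius M x)
    ≡⟨ cong -ℤ_ (∑-below M x y (mobius M x)) ⟩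
  -ℤ ∑ˢ (λ z → below x y z ▷ isFlat M z ▷ mobius M x z) ∎
  where open ≡-Reasoning

between : ∀ {n} → Subset n → Subset n → Subset n → Bool
between x y z = (x ⊆ᵇ z) ∧ (z ⊆ᵇ y)

-- An entry of `μ ζ = 1`: off the diagonal, the term at `z = y` is by the recursion the negative of
-- all the others together.
mobius-sum : ∀ M {x y} → isFlat M x ≡ true → isFlat M y ≡ true → x ≼ y →
             ∑ˢ (λ z → isFlat M z ▷ between x y z ▷ mobius M x z) ≡ (x ≟ᵇ y) ▷ 1ℤ
mobius-sum M {x} {y} flatx flaty x≼y with x ≟ˢ y
... | yes refl = begin
  ∑ˢ (λ z → isFlat M z ▷ between x x z ▷ mobius M x z)
    ≡⟨ ∑ˢ-single x _ (λ z z≢x → ▷-zero (isFlat M z) λ _ → ▷-zero (between x x z) λ e →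
         ⊥-elim (z≢x (≼-antisym (⊆ᵇ⇒≼ z x (∧-elimʳ {x ⊆ᵇ z} e)) (⊆ᵇ⇒≼ x z (∧-elimˡ e))))) ⟩
  isFlat M x ▷ between x x x ▷ mobius M x x
    ≡⟨ cong₂ (λ a b → a ▷ b ▷ mobius M x x) flatx (≟ᵇ-refl x) ⟩
  mobius M x x
    ≡⟨ mobius-refl M x ⟩
  1ℤ
    ≡⟨ cong (_▷ 1ℤ) (≟ᵇ-refl x) ⟨
  (x ≟ᵇ x) ▷ 1ℤ ∎
  where open ≡-Reasoning
... | no x≢y = begin
  ∑ˢ (λ z → isFlat M z ▷ between x y z ▷ mobius M x z)
    ≡⟨ ∑ˢ-split y _ ⟩
  isFlat M y ▷ between x y y ▷ mobius M x y +ℤ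
    ∑ˢ (λ z → not (does (z ≟ˢ y)) ▷ isFlat M z ▷ between x y z ▷ mobius M x z)
    ≡⟨ cong₂ _+ℤ_
         (trans (cong₂ (λ a b → a ▷ b ▷ mobius M x y) flaty (∧-intro (≼⇒⊆ᵇ x≼y) (≼⇒⊆ᵇ (≼-refl y))))
                (mobius-rec M x≼y x≢y))
         (∑-cong (allSubsets (n M)) rest) ⟩
  -ℤ S +ℤ S
    ≡⟨ ℤₚ.+-inverseˡ S ⟩
  0ℤ
    ≡⟨ cong (_▷ 1ℤ) (≢⇒≟ᵇ x≢y) ⟨
  (x ≟ᵇ y) ▷ 1ℤ ∎
  where
  open ≡-Reasoning
  S : ℤ
  S = ∑ˢ (λ z → below x y z ▷ isFlat M z ▷ mobius M x z)
  rest : ∀ z → not (does (z ≟ˢ y)) ▷ isFlat M z ▷ between x y z ▷ mobius M x z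
             ≡ below x y z ▷ isFlat M z ▷ mobius M x z
  rest z with z ≟ˢ y
  ... | yes refl = sym (cong (_▷ (isFlat M z ▷ mobius M x z))
    (≢true⇒false {below x z z} λ e →
       true≢false (∧-elimʳ {z ⊆ᵇ z} (∧-elimʳ {x ⊆ᵇ z} e)) (cong not (≟ᵇ-refl z))))
  ... | no z≢y = trans (▷-comm (isFlat M z) (between x y z))
    (cong (λ b → ((x ⊆ᵇ z) ∧ b) ▷ (isFlat M z ▷ mobius M x z))
      (sym (trans (cong (λ b → (z ⊆ᵇ y) ∧ not b) (≢⇒≟ᵇ z≢y)) (∧-identityʳ _))))

-- The incidence algebra of the lattice of flats, inside the matrices indexed by all subsets

-- The index types are left free so that the families built from `P` and `Q` can be column and row
-- vectors, and `⊙-assoc` covers their products too.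
Matrix : Set → Set → Set
Matrix J K = J → K → Poly

infix 4 _≋_
infixr 7 _⊙_

_≋_ : ∀ {J K} → Matrix J K → Matrix J K → Set
A ≋ B = ∀ x y → A x y ≈ B x y

_⊙_ : ∀ {J K n} → Matrix J (Subset n) → Matrix (Subset n) K → Matrix J K
(A ⊙ B) x y = ∑ᴾ (allSubsets _) (λ z → A x z ⊛ B z y)

≋-trans : ∀ {J K} {A B C : Matrix J K} → A ≋ B → B ≋ C → A ≋ C
≋-trans e f x y j = trans (e x y j) (f x y j)

≋-sym : ∀ {J K} {A B : Matrix J K} → A ≋ B → B ≋ A
≋-sym e x y j = sym (e x y j)

⊙-congʳ : ∀ {J K n} {A A′ : Matrix J (Subset n)} (B : Matrix (Subset n) K) → A ≋ A′ → A ⊙ B ≋ A′ ⊙ B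
⊙-congʳ {n = n} B e x y j = ∑-cong (allSubsets n) (λ z → ⊛-congʳ (B z y) (e x z) j)

⊙-congˡ : ∀ {J K n} (A : Matrix J (Subset n)) {B B′ : Matrix (Subset n) K} → B ≋ B′ → A ⊙ B ≋ A ⊙ B′
⊙-congˡ {n = n} A e x y j = ∑-cong (allSubsets n) (λ z → ⊛-congˡ (A x z) (e z y) j)

⊙-assoc : ∀ {J K m n} (A : Matrix J (Subset m)) (B : Matrix (Subset m) (Subset n)) (C : Matrix (Subset n) K) →
          (A ⊙ B) ⊙ C ≋ A ⊙ (B ⊙ C)
⊙-assoc {m = m} {n} A B C x y j = begin
  ∑ˢ (λ w → (∑ᴾ (allSubsets m) (λ z → A x z ⊛ B z w) ⊛ C w y) j)
    ≡⟨ ∑-cong (allSubsets n) (λ w → ⊛-∑ˡ (allSubsets m) (λ z → A x z ⊛ B z w) (C w y) j) ⟩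
  ∑ˢ (λ w → ∑ˢ (λ z → ((A x z ⊛ B z w) ⊛ C w y) j))
    ≡⟨ ∑-swap (allSubsets n) (allSubsets m) (λ w z → ((A x z ⊛ B z w) ⊛ C w y) j) ⟩
  ∑ˢ (λ z → ∑ˢ (λ w → ((A x z ⊛ B z w) ⊛ C w y) j))
    ≡⟨ ∑-cong (allSubsets m) (λ z → ∑-cong (allSubsets n) (λ w → ⊛-assoc (A x z) (B z w) (C w y) j)) ⟩
  ∑ˢ (λ z → ∑ˢ (λ w → (A x z ⊛ (B z w ⊛ C w y)) j))
    ≡⟨ ∑-cong (allSubsets m) (λ z → ⊛-∑ʳ (allSubsets n) (A x z) (λ w → B z w ⊛ C w y) j) ⟨
  ∑ˢ (λ z → (A x z ⊛ ∑ᴾ (allSubsets n) (λ w → B z w ⊛ C w y)) j) ∎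
  where open ≡-Reasoning

⊛-mask-mask : ∀ b c p q → mask b p ⊛ mask c q ≈ mask b (mask c (p ⊛ q))
⊛-mask-mask b c p q j = trans (⊛-maskˡ b p (mask c q) j) (cong (b ▷_) (⊛-maskʳ c p q j))

one≈mono : one ≈ mono 1ℤ 0
one≈mono zero    = refl
one≈mono (suc j) = refl

reflect-mono : ∀ a b c → reflect (a + b) (mono c a) ≈ mono c b
reflect-mono a b c j with position j (a + b)
... | beyond ab<j = trans (reflect-beyond (a + b) (mono c a) ab<j)
  (sym (mono-off c (ℕₚ.<⇒≢ (ℕₚ.≤-<-trans (ℕₚ.m≤n+m b a) ab<j))))
... | within l j+l≡a+b = trans (cong (λ d → reflect d (mono c a) j) (sym j+l≡a+b))
  (trans (reflect-at j l (mono c a)) (cong (_▷ c) (Bool-ext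
    (λ e → T⇒true (ℕₚ.≡⇒≡ᵇ b j (b≡j (ℕₚ.≡ᵇ⇒≡ a l (true⇒T e)))))
    (λ e → T⇒true (ℕₚ.≡⇒≡ᵇ a l (a≡l (ℕₚ.≡ᵇ⇒≡ b j (true⇒T e))))))))
  where
  b≡j : a ≡ l → b ≡ j
  b≡j refl = ℕₚ.+-cancelˡ-≡ a b j (trans (sym j+l≡a+b) (ℕₚ.+-comm j a))
  a≡l : b ≡ j → a ≡ l
  a≡l refl = ℕₚ.+-cancelʳ-≡ b a l (trans (sym j+l≡a+b) (ℕₚ.+-comm b l))

-- Möbius, zeta and characteristic matrices of a matroid

module Incidence (M : RankFn) (mat : IsMatroid M) where

  subsets : List (Subset (n M))
  subsets = allSubsets (n M)

  leF : Subset (n M) → Subset (n M) → Bool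
  leF x y = isFlat M x ∧ isFlat M y ∧ (x ⊆ᵇ y)

  leF-flatˡ : ∀ {x y} → leF x y ≡ true → isFlat M x ≡ true
  leF-flatˡ = ∧-elimˡ

  leF-flatʳ : ∀ {x y} → leF x y ≡ true → isFlat M y ≡ true
  leF-flatʳ {x} e = ∧-elimˡ (∧-elimʳ {isFlat M x} e)

  leF⇒≼ : ∀ {x y} → leF x y ≡ true → x ≼ y
  leF⇒≼ {x} {y} e = ⊆ᵇ⇒≼ x y (∧-elimʳ {isFlat M y} (∧-elimʳ {isFlat M x} e))

  leF-intro : ∀ {x y} → isFlat M x ≡ true → isFlat M y ≡ true → x ≼ y → leF x y ≡ true
  leF-intro flatx flaty x≼y = ∧-intro flatx (∧-intro flaty (≼⇒⊆ᵇ x≼y))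

  -- The unit of the incidence algebra is supported on flats only. Among matrices indexed by all
  -- subsets it is neutral just for those vanishing off the flats, whence the hypotheses of `Id-⊙`
  -- and `⊙-Id`.
  Id : Matrix (Subset (n M)) (Subset (n M))
  Id x y = mask (isFlat M x ∧ (x ≟ᵇ y)) one

  Id-⊙ : ∀ {K} (B : Matrix (Subset (n M)) K) →
         (∀ x y → isFlat M x ≡ false → ∀ j → B x y j ≡ 0ℤ) → Id ⊙ B ≋ B
  Id-⊙ B h x y j = trans
    (∑ˢ-single x (λ z → (Id x z ⊛ B z y) j) (λ z z≢x → trans
      (⊛-maskˡ (isFlat M x ∧ (x ≟ᵇ z)) one (B z y) j)
      (▷-zero (isFlat M x ∧ (x ≟ᵇ z)) (λ e → ⊥-elim (z≢x (sym (≟ᵇ⇒≡ x z (∧-elimʳ {isFlat M x} e))))))))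
    (diagonal (isFlat M x) refl)
    where
    diagonal : ∀ b → isFlat M x ≡ b → (Id x x ⊛ B x y) j ≡ B x y j
    diagonal true  e = trans
      (⊛-congʳ (B x y) (λ i → cong (λ b → mask b one i) (∧-intro e (≟ᵇ-refl x))) j) (one-⊛ (B x y) j)
    diagonal false e = trans (⊛-maskˡ (isFlat M x ∧ (x ≟ᵇ x)) one (B x y) j)
      (trans (cong (λ b → (b ∧ (x ≟ᵇ x)) ▷ _) e) (sym (h x y e j)))

  ⊙-Id : ∀ {J} (A : Matrix J (Subset (n M))) →
         (∀ x y → isFlat M y ≡ false → ∀ j → A x y j ≡ 0ℤ) → A ⊙ Id ≋ A
  ⊙-Id A h x y j = trans
    (∑ˢ-single y (λ z → (A x z ⊛ Id z y) j) (λ z z≢y → trans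
      (⊛-maskʳ (isFlat M z ∧ (z ≟ᵇ y)) (A x z) one j)
      (▷-zero (isFlat M z ∧ (z ≟ᵇ y)) (λ e → ⊥-elim (z≢y (≟ᵇ⇒≡ z y (∧-elimʳ {isFlat M z} e)))))))
    (diagonal (isFlat M y) refl)
    where
    diagonal : ∀ b → isFlat M y ≡ b → (A x y ⊛ Id y y) j ≡ A x y j
    diagonal true  e = trans
      (⊛-congˡ (A x y) (λ i → cong (λ b → mask b one i) (∧-intro e (≟ᵇ-refl y))) j) (⊛-one (A x y) j)
    diagonal false e = trans (⊛-maskʳ (isFlat M y ∧ (y ≟ᵇ y)) (A x y) one j)
      (trans (cong (λ b → (b ∧ (y ≟ᵇ y)) ▷ _) e) (sym (h x y e j)))

  Grading : Set
  Grading = Subset (n M) → Subset (n M) → ℕ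

  -- The exponent is a parameter: `trivial` gives `μ` and `ζ`, and `rkDiff` gives their reflections
  -- `μʳ` and `ζʳ`.
  Möb Zeta : Grading → Matrix (Subset (n M)) (Subset (n M))
  Möb  e x y = mask (leF x y) (mono (mobius M x y) (e x y))
  Zeta e x y = mask (leF x y) (mono 1ℤ (e x y))

  trivial rkDiff : Grading
  trivial x y = 0
  rkDiff  x y = rk M y ∸ rk M x

  -- Independent gradings make one formula serve all four products: `μ ζʳ` and `μʳ ζ`, which are
  -- characteristic matrices, and `μ ζ` and `μʳ ζʳ`, which are the identity.
  Möb-⊙-Zeta : ∀ e e′ x y → (Möb e ⊙ Zeta e′) x y ≈
    mask (leF x y) (∑ᴾ subsets (λ z → mask (isFlat M z) (mask (between x y z) (mono (mobius M x z) (e x z + e′ z y)))))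
  Möb-⊙-Zeta e e′ x y j = trans
    (∑-cong subsets (λ z → begin
      (Möb e x z ⊛ Zeta e′ z y) j
        ≡⟨ ⊛-mask-mask (leF x z) (leF z y) (mono (mobius M x z) (e x z)) (mono 1ℤ (e′ z y)) j ⟩
      leF x z ▷ leF z y ▷ (mono (mobius M x z) (e x z) ⊛ mono 1ℤ (e′ z y)) j
        ≡⟨ cong (λ v → leF x z ▷ leF z y ▷ v) (trans (mono-⊛-mono (mobius M x z) (e x z) 1ℤ (e′ z y) j)
             (cong (λ c → mono c (e x z + e′ z y) j) (ℤₚ.*-identityʳ (mobius M x z)))) ⟩
      leF x z ▷ leF z y ▷ v z
        ≡⟨ ▷-∧ (leF x z) (leF z y) ⟨
      (leF x z ∧ leF z y) ▷ v z
        ≡⟨ cong (_▷ v z) (factor z) ⟩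
      (leF x y ∧ (isFlat M z ∧ between x y z)) ▷ v z
        ≡⟨ ▷-∧ (leF x y) (isFlat M z ∧ between x y z) ⟩
      leF x y ▷ (isFlat M z ∧ between x y z) ▷ v z
        ≡⟨ cong (leF x y ▷_) (▷-∧ (isFlat M z) (between x y z)) ⟩
      leF x y ▷ isFlat M z ▷ between x y z ▷ v z ∎))
    (∑-▷ subsets (leF x y) (λ z → isFlat M z ▷ between x y z ▷ v z))
    where
    open ≡-Reasoning
    v : Subset (n M) → ℤ
    v z = mono (mobius M x z) (e x z + e′ z y) j
    factor : ∀ z → leF x z ∧ leF z y ≡ leF x y ∧ (isFlat M z ∧ between x y z)
    factor z = Bool-ext
      (λ h → let xz = ∧-elimˡ h ; zy = ∧-elimʳ {leF x z} h in
        ∧-intro (leF-intro (leF-flatˡ {x} {z} xz) (leF-flatʳ {z} {y} zy) (≼-trans (leF⇒≼ {x} {z} xz) (leF⇒≼ {z} {y} zy)))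
          (∧-intro (leF-flatʳ {x} {z} xz) (∧-intro (≼⇒⊆ᵇ (leF⇒≼ {x} {z} xz)) (≼⇒⊆ᵇ (leF⇒≼ {z} {y} zy)))))
      (λ h → let xy = ∧-elimˡ {leF x y} h ; zb = ∧-elimʳ {leF x y} h
                 flatz = ∧-elimˡ {isFlat M z} zb ; b = ∧-elimʳ {isFlat M z} zb in
        ∧-intro (leF-intro (leF-flatˡ {x} {y} xy) flatz (⊆ᵇ⇒≼ x z (∧-elimˡ b)))
                (leF-intro flatz (leF-flatʳ {x} {y} xy) (⊆ᵇ⇒≼ z y (∧-elimʳ {x ⊆ᵇ z} b))))

  -- Additivity makes the exponent independent of `z`, so the power of `t` comes out of the sum and
  -- `mobius-sum` remains; on the diagonal that power is 1.
  Möb-⊙-Zeta-Id : ∀ e → (∀ x → e x x ≡ 0) → (∀ {x y z} → x ≼ z → z ≼ y → e x z + e z y ≡ e x y) →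
                  Möb e ⊙ Zeta e ≋ Id
  Möb-⊙-Zeta-Id e e-refl e-add x y j = begin
    (Möb e ⊙ Zeta e) x y j
      ≡⟨ Möb-⊙-Zeta e e x y j ⟩
    leF x y ▷ ∑ˢ (λ z → isFlat M z ▷ between x y z ▷ mono (mobius M x z) (e x z + e z y) j)
      ≡⟨ ▷-congʳ (leF x y) (λ h → trans
           (∑-cong subsets (λ z → trans
             (cong (isFlat M z ▷_) (trans
               (▷-congʳ (between x y z) (λ b → cong (λ a → mono (mobius M x z) a j)
                 (e-add (⊆ᵇ⇒≼ x z (∧-elimˡ b)) (⊆ᵇ⇒≼ z y (∧-elimʳ {x ⊆ᵇ z} b)))))
               (▷-comm (between x y z) (e x y ≡ᵇ j))))
             (▷-comm (isFlat M z) (e x y ≡ᵇ j))))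
           (trans (∑-▷ subsets (e x y ≡ᵇ j) (λ z → isFlat M z ▷ between x y z ▷ mobius M x z))
             (cong ((e x y ≡ᵇ j) ▷_) (mobius-sum M (leF-flatˡ {x} {y} h) (leF-flatʳ {x} {y} h) (leF⇒≼ {x} {y} h))))) ⟩
    leF x y ▷ (e x y ≡ᵇ j) ▷ (x ≟ᵇ y) ▷ 1ℤ
      ≡⟨ final (x ≟ˢ y) ⟩
    Id x y j ∎
    where
    open ≡-Reasoning
    final : Dec (x ≡ y) → leF x y ▷ (e x y ≡ᵇ j) ▷ (x ≟ᵇ y) ▷ 1ℤ ≡ Id x y j
    final (yes refl) = ▷-cong
      (Bool-ext {leF x x} {isFlat M x ∧ (x ≟ᵇ x)} (λ h → ∧-intro (leF-flatˡ {x} {x} h) (≟ᵇ-refl x))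
                (λ h → leF-intro {x} {x} (∧-elimˡ h) (∧-elimˡ h) (≼-refl x)))
      (λ _ → trans (cong₂ (λ a b → (a ≡ᵇ j) ▷ b ▷ 1ℤ) (e-refl x) (≟ᵇ-refl x)) (sym (one≈mono j)))
    final (no x≢y) = trans
      (▷-zero (leF x y) (λ _ → ▷-zero (e x y ≡ᵇ j) (λ _ → cong (_▷ 1ℤ) (≢⇒≟ᵇ x≢y))))
      (sym (▷-zero (isFlat M x ∧ (x ≟ᵇ y)) (λ h → ⊥-elim (x≢y (≟ᵇ⇒≡ x y (∧-elimʳ {isFlat M x} h))))))

  Möb-zeroˡ : ∀ e x y → isFlat M x ≡ false → ∀ j → Möb e x y j ≡ 0ℤ
  Möb-zeroˡ e x y h j = ▷-zero (leF x y) (λ k → true≢false (leF-flatˡ {x} {y} k) h)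

  Möb-zeroʳ : ∀ e x y → isFlat M y ≡ false → ∀ j → Möb e x y j ≡ 0ℤ
  Möb-zeroʳ e x y h j = ▷-zero (leF x y) (λ k → true≢false (leF-flatʳ {x} {y} k) h)

  Zeta-zeroˡ : ∀ e x y → isFlat M x ≡ false → ∀ j → Zeta e x y j ≡ 0ℤ
  Zeta-zeroˡ e x y h j = ▷-zero (leF x y) (λ k → true≢false (leF-flatˡ {x} {y} k) h)

  -- Möb is unitriangular, so it may be cancelled on the left by downward induction on the row
  -- index; hence its right inverse Zeta is also a left inverse.
  Zeta-⊙-Möb-Id : Zeta trivial ⊙ Möb trivial ≋ Id
  Zeta-⊙-Möb-Id x y j = go (suc (n M)) x (s≤s (ℕₚ.m∸n≤m (n M) ∣ x ∣))
    where
    U Z W : Matrix (Subset (n M)) (Subset (n M))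
    U = Möb trivial
    Z = Zeta trivial
    W = Z ⊙ U
    UW≋UI : U ⊙ W ≋ U ⊙ Id
    UW≋UI = ≋-trans (≋-sym (⊙-assoc U Z U))
      (≋-trans (⊙-congʳ U (Möb-⊙-Zeta-Id trivial (λ _ → refl) (λ _ _ → refl)))
        (≋-trans (Id-⊙ U (Möb-zeroˡ trivial)) (≋-sym (⊙-Id U (Möb-zeroʳ trivial)))))
    unit : ∀ x (B : Poly) → isFlat M x ≡ true → (U x x ⊛ B) j ≡ B j
    unit x B flatx = trans
      (⊛-congʳ B (λ i → trans
        (cong₂ (λ b c → b ▷ mono c 0 i) (leF-intro {x} {x} flatx flatx (≼-refl x)) (mobius-refl M x))
        (sym (one≈mono i))) j)
      (one-⊛ B j)
    go : ∀ k x → n M ∸ ∣ x ∣ < k → W x y j ≡ Id x y j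
    go (suc k) x (s≤s le) = row (isFlat M x) refl
      where
      row : ∀ b → isFlat M x ≡ b → W x y j ≡ Id x y j
      row false h = trans
        (∑-zero subsets (λ z → trans (⊛-congʳ (U z y) (Zeta-zeroˡ trivial x z h) j)
                                     (⊛-vanish (λ _ → 0ℤ) (U z y) j (λ _ _ _ → inj₁ refl))))
        (sym (cong (λ b → (b ∧ (x ≟ᵇ y)) ▷ one j) h))
      row true h = trans (sym (unit x (W x y) h))
        (trans (∑ˢ-cancel x (λ A → (U x A ⊛ W A y) j) (λ A → (U x A ⊛ Id A y) j) (UW≋UI x y j) off-diagonal)
               (unit x (Id x y) h))
        where
        off-diagonal : ∀ A → A ≢ x → (U x A ⊛ W A y) j ≡ (U x A ⊛ Id A y) j
        off-diagonal A A≢x = trans (⊛-maskˡ (leF x A) c (W A y) j) (trans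
          (▷-congʳ (leF x A) (λ e → trans (const-⊛ c (W A y) (λ _ → refl) j) (trans
            (cong (c 0 *ℤ_) (go k A (ℕₚ.<-≤-trans
              (ℕₚ.∸-monoʳ-< (≼∧≢⇒∣∣< (leF⇒≼ {x} {A} e) (A≢x ∘ sym)) (Sₚ.∣p∣≤n A)) le)))
            (sym (const-⊛ c (Id A y) (λ _ → refl) j)))))
          (sym (⊛-maskˡ (leF x A) c (Id A y) j)))
          where
          c : Poly
          c = mono (mobius M x A) 0

  -- These are `χ` and `χʳ`, each with entries taken from the minors that occur literally in its
  -- recursion: contract then restrict for `P`, restrict then contract for `Q`.
  Upper Lower : Matrix (Subset (n M)) (Subset (n M))
  Upper x y = mask (leF x y) (charPoly (restrict (contract M x) y))
  Lower x y = mask (leF x y) (reflect (rk M y ∸ rk M x) (charPoly (contract (restrict M y) (x ∪ ∁ y))))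

  Upper≋ : Upper ≋ Möb trivial ⊙ Zeta rkDiff
  Upper≋ x y j = trans
    (▷-congʳ (leF x y) (λ e → charPoly-upper-interval mat
      (isFlat⇒Flat M x (leF-flatˡ {x} {y} e)) (isFlat⇒Flat M y (leF-flatʳ {x} {y} e)) (leF⇒≼ {x} {y} e) j))
    (sym (Möb-⊙-Zeta trivial rkDiff x y j))

  rkDiff-+ : ∀ {x y z} → x ≼ z → z ≼ y → rkDiff x z + rkDiff z y ≡ rkDiff x y
  rkDiff-+ {x} {y} {z} x≼z z≼y = trans (ℕₚ.+-comm (rkDiff x z) (rkDiff z y))
    (trans (sym (ℕₚ.+-∸-assoc (rkDiff z y) (rk-mono mat x≼z)))
           (cong (_∸ rk M x) (ℕₚ.m∸n+n≡m (rk-mono mat z≼y))))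

  -- Reflecting in degree `rkDiff x y` turns the exponent `rkDiff z y` into `rkDiff x z`: the
  -- grading moves from the zeta factor to the Möbius factor.
  Lower≋ : Lower ≋ Möb rkDiff ⊙ Zeta trivial
  Lower≋ x y j = trans (▷-congʳ (leF x y) reflected) (sym (Möb-⊙-Zeta rkDiff trivial x y j))
    where
    open ≡-Reasoning
    reflected : leF x y ≡ true → reflect (rkDiff x y) (charPoly (contract (restrict M y) (x ∪ ∁ y))) j ≡
      ∑ˢ (λ z → isFlat M z ▷ between x y z ▷ mono (mobius M x z) (rkDiff x z + 0) j)
    reflected e = begin
      reflect (rkDiff x y) (charPoly (contract (restrict M y) (x ∪ ∁ y))) j
        ≡⟨ reflect-cong (rkDiff x y) (charPoly-lower-interval mat
             (isFlat⇒Flat M x (leF-flatˡ {x} {y} e)) (isFlat⇒Flat M y (leF-flatʳ {x} {y} e)) (leF⇒≼ {x} {y} e)) j ⟩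
      reflect (rkDiff x y) (∑ᴾ subsets (λ z → mask (isFlat M z) (mask (between x y z) (q z)))) j
        ≡⟨ reflect-∑ (rkDiff x y) subsets (λ z → mask (isFlat M z) (mask (between x y z) (q z))) j ⟩
      ∑ˢ (λ z → reflect (rkDiff x y) (mask (isFlat M z) (mask (between x y z) (q z))) j)
        ≡⟨ ∑-cong subsets (λ z → trans
             (reflect-mask (rkDiff x y) (isFlat M z) (mask (between x y z) (q z)) j)
             (cong (isFlat M z ▷_) (trans
               (reflect-mask (rkDiff x y) (between x y z) (q z) j)
               (▷-congʳ (between x y z) (λ b → reflected-term z (⊆ᵇ⇒≼ x z (∧-elimˡ b)) (⊆ᵇ⇒≼ z y (∧-elimʳ {x ⊆ᵇ z} b))))))) ⟩
      ∑ˢ (λ z → isFlat M z ▷ between x y z ▷ mono (mobius M x z) (rkDiff x z + 0) j) ∎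
      where
      q : Subset (n M) → Poly
      q z = mono (mobius M x z) (rkDiff z y)
      reflected-term : ∀ z → x ≼ z → z ≼ y →
        reflect (rkDiff x y) (q z) j ≡ mono (mobius M x z) (rkDiff x z + 0) j
      reflected-term z x≼z z≼y = trans
        (cong (λ d → reflect d (q z) j) (trans (sym (rkDiff-+ x≼z z≼y)) (ℕₚ.+-comm (rkDiff x z) (rkDiff z y))))
        (trans (reflect-mono (rkDiff z y) (rkDiff x z) (mobius M x z) j)
               (cong (λ a → mono (mobius M x z) a j) (sym (ℕₚ.+-identityʳ (rkDiff x z)))))

  -- The product `μʳ ζ μ ζʳ` collapses from the inside: first `ζ μ = 1`, then `μʳ ζʳ = 1`, the
  -- latter because `rkDiff` is additive along chains.
  Lower-⊙-Upper : Lower ⊙ Upper ≋ Id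
  Lower-⊙-Upper = ≋-trans (⊙-congʳ Upper Lower≋) (≋-trans (⊙-congˡ (Ur ⊙ Z) Upper≋)
    (≋-trans (⊙-assoc Ur Z (U ⊙ Zr)) (≋-trans (⊙-congˡ Ur (≋-sym (⊙-assoc Z U Zr)))
      (≋-trans (⊙-congˡ Ur (⊙-congʳ Zr Zeta-⊙-Möb-Id)) (≋-trans (⊙-congˡ Ur (Id-⊙ Zr (Zeta-zeroˡ rkDiff)))
        (Möb-⊙-Zeta-Id rkDiff (λ x → ℕₚ.n∸n≡0 (rk M x)) rkDiff-+))))))
    where
    U Ur Z Zr : Matrix (Subset (n M)) (Subset (n M))
    U  = Möb trivial
    Ur = Möb rkDiff
    Z  = Zeta trivial
    Zr = Zeta rkDiff

-- Invariance under pointwise equality of rank functions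

module _ {m : ℕ} where

  infix 4 _≗ʳ_

  _≗ʳ_ : (r₁ r₂ : Subset m → ℕ) → Set
  r₁ ≗ʳ r₂ = ∀ A → r₁ A ≡ r₂ A

  isFlat-ext : ∀ {r₁ r₂} → r₁ ≗ʳ r₂ → ∀ F → isFlat (mkRankFn m r₁) F ≡ isFlat (mkRankFn m r₂) F
  isFlat-ext {r₁} {r₂} eq F = Bool-ext
    (λ e → Flat⇒isFlat (mkRankFn m r₂) F (λ i i∉F →
       subst₂ _<_ (eq F) (eq (F ∪ ⁅ i ⁆)) (isFlat⇒Flat (mkRankFn m r₁) F e i i∉F)))
    (λ e → Flat⇒isFlat (mkRankFn m r₁) F (λ i i∉F →
       subst₂ _<_ (sym (eq F)) (sym (eq (F ∪ ⁅ i ⁆))) (isFlat⇒Flat (mkRankFn m r₂) F e i i∉F)))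

  mobiusF-ext : ∀ {r₁ r₂} → r₁ ≗ʳ r₂ → ∀ k x y →
                mobiusF (mkRankFn m r₁) k x y ≡ mobiusF (mkRankFn m r₂) k x y
  mobiusF-ext eq zero    x y = refl
  mobiusF-ext {r₁} {r₂} eq (suc k) x y = cong (mobius-step (x ≟ᵇ y) (x ⊆ᵇ y))
    (trans (∑-below (mkRankFn m r₁) x y _) (trans
      (∑-cong (allSubsets m) (λ z → cong (below x y z ▷_)
        (cong₂ _▷_ (isFlat-ext eq z) (mobiusF-ext eq k x z))))
      (sym (∑-below (mkRankFn m r₂) x y _))))

  bot-ext : ∀ {r₁ r₂} → r₁ ≗ʳ r₂ → bot (mkRankFn m r₁) ≡ bot (mkRankFn m r₂)
  bot-ext {r₁} {r₂} eq = subset-ext λ i → trans (lookup-bot (mkRankFn m r₁) i)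
    (trans (cong₂ _≡ᵇ_ (eq (⊥ ∪ ⁅ i ⁆)) (eq ⊥)) (sym (lookup-bot (mkRankFn m r₂) i)))

  charPoly-ext : ∀ {r₁ r₂} → r₁ ≗ʳ r₂ → charPoly (mkRankFn m r₁) ≈ charPoly (mkRankFn m r₂)
  charPoly-ext {r₁} {r₂} eq j = trans (∑-flats (mkRankFn m r₁) _) (trans
    (∑-cong (allSubsets m) (λ F → cong₂ _▷_ (isFlat-ext eq F)
      (cong₂ (λ c a → mono c a j)
        (trans (cong (λ B → mobius (mkRankFn m r₁) B F) (bot-ext eq))
               (mobiusF-ext eq (suc m) (bot (mkRankFn m r₂)) F))
        (cong₂ _∸_ (eq ⊤) (eq F)))))
    (sym (∑-flats (mkRankFn m r₂) _)))

charPoly-rank0 : ∀ M → rank M ≡ 0 → ∀ j → charPoly M (suc j) ≡ 0ℤ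
charPoly-rank0 M rank≡0 j = ∑-zero (flats M) (λ F →
  mono-off (mobius M (bot M) F)
    (λ e → ℕₚ.1+n≢0 (trans (sym e) (trans (cong (_∸ rk M F) rank≡0) (ℕₚ.0∸n≡0 (rk M F))))))

rank-contract-≤ : ∀ M F → rank (contract M F) ≤ rank M
rank-contract-≤ M F = subst (_≤ rank M) (sym (rank-contract M F)) (ℕₚ.m∸n≤m (rank M) (rk M F))

sgn-involutive : ∀ k a → sgn k *ℤ (sgn k *ℤ a) ≡ a
sgn-involutive zero    a = trans (ℤₚ.*-identityˡ _) (ℤₚ.*-identityˡ a)
sgn-involutive (suc k) a = trans (square (sgn k) a) (sgn-involutive k a)
  where
  square : ∀ s a → (-1ℤ *ℤ s) *ℤ ((-1ℤ *ℤ s) *ℤ a) ≡ s *ℤ (s *ℤ a)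
  square = solve-∀

sgn-cancel : ∀ k {a b} → sgn k *ℤ a ≡ sgn k *ℤ b → a ≡ b
sgn-cancel k {a} {b} e =
  trans (sym (sgn-involutive k a)) (trans (cong (sgn k *ℤ_) e) (sgn-involutive k b))

sgn-odd : ∀ k → sgn (2 * k + 1) ≡ -1ℤ
sgn-odd zero    = refl
sgn-odd (suc k) rewrite ℕₚ.+-suc k (k + 0) = trans (square (sgn (2 * k + 1))) (sgn-odd k)
  where
  square : ∀ s → -1ℤ *ℤ (-1ℤ *ℤ s) ≡ s
  square = solve-∀

rank-cases : ∀ {A : Set} (r : ℕ) → (r ≡ 0 → A) → (0 < r → A) → A
rank-cases zero    z p = z refl
rank-cases (suc r) z p = p (s≤s z≤n)

-- Degree bounds and extensionality of P and Q

module KL (P Q : RankFn → Poly) (kl : IsKLPair P Q) where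

  -- The strict inequality forces `j` to be positive, so the bound also holds in rank 0, where the
  -- polynomial is 1 and the weak bound would fail at `j = 0`.
  P-degree : ∀ {M} → IsMatroid M → ∀ {j} → rank M < 2 * j → P M j ≡ 0ℤ
  P-degree {M} mat {zero}  ()
  P-degree {M} mat {suc j} h = rank-cases (rank M)
    (λ z → rank0-P kl M mat z (suc j)) (λ p → deg-P kl M mat p (suc j) (ℕₚ.<⇒≤ h))

  Q-degree : ∀ {M} → IsMatroid M → ∀ {j} → rank M < 2 * j → Q M j ≡ 0ℤ
  Q-degree {M} mat {zero}  ()
  Q-degree {M} mat {suc j} h = rank-cases (rank M)
    (λ z → rank0-Q kl M mat z (suc j)) (λ p → deg-Q kl M mat p (suc j) (ℕₚ.<⇒≤ h))

  P-term : (M : RankFn) → Subset (n M) → Poly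
  P-term M F = charPoly (restrict M F) ⊛ P (contract M F)

  Q-term : (M : RankFn) → Subset (n M) → Poly
  Q-term M F = Q (restrict M F) ⊛ reflect (rank M ∸ rk M F) (charPoly (contract M F))

  P-recursion : ∀ {M} → IsMatroid M → ∀ j →
    reflect (rank M) (P M) j ≡ ∑ˢ (λ F → isFlat M F ▷ P-term M F j)
  P-recursion {M} mat j = trans (rec-P kl M mat j)
    (trans (sumP-map (P-term M) (flats M) j) (∑-flats M (λ F → P-term M F j)))

  Q-recursion : ∀ {M} → IsMatroid M → ∀ j →
    sgn (rank M) *ℤ reflect (rank M) (Q M) j ≡ ∑ˢ (λ F → isFlat M F ▷ (sgn (rk M F) *ℤ Q-term M F j))
  Q-recursion {M} mat j = trans (rec-Q kl M mat j)
    (trans (sumP-map (λ F → sgn (rk M F) · Q-term M F) (flats M) j)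
           (∑-flats M (λ F → sgn (rk M F) *ℤ Q-term M F j)))

  -- Contracting a set of rank 0 keeps the full rank, out of reach of an induction on the rank. Such
  -- a term has a constant characteristic polynomial, so its degree is that of `P` and stays below
  -- the upper half.
  P-term-rank0 : ∀ {M} → IsMatroid M → ∀ {F l} → rk M F ≡ 0 → rank M < 2 * l → P-term M F l ≡ 0ℤ
  P-term-rank0 {M} mat {F} {l} z h = ⊛-vanish (charPoly (restrict M F)) (P (contract M F)) l factor
    where
    factor : ∀ i g → i + g ≡ l → charPoly (restrict M F) i ≡ 0ℤ ⊎ P (contract M F) g ≡ 0ℤ
    factor zero    g refl = inj₂ (P-degree (contract-isMatroid mat F) (ℕₚ.≤-<-trans (rank-contract-≤ M F) h))
    factor (suc i) g _    = inj₁ (charPoly-rank0 (restrict M F) (trans (rank-restrict M F) z) i)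

  -- The counterpart for `Q`: restriction to a spanning set keeps the full rank, and corank 0
  -- truncates the reflected characteristic polynomial to a constant.
  Q-term-spanning : ∀ {M} → IsMatroid M → ∀ {F l} → rk M F ≡ rank M → rank M < 2 * l → Q-term M F l ≡ 0ℤ
  Q-term-spanning {M} mat {F} {l} s h =
    ⊛-vanish (Q (restrict M F)) (reflect (rank M ∸ rk M F) (charPoly (contract M F))) l factor
    where
    corank≡0 : rank M ∸ rk M F ≡ 0
    corank≡0 = trans (cong (rank M ∸_) s) (ℕₚ.n∸n≡0 (rank M))
    factor : ∀ i g → i + g ≡ l → Q (restrict M F) i ≡ 0ℤ ⊎ reflect (rank M ∸ rk M F) (charPoly (contract M F)) g ≡ 0ℤ
    factor i (suc g) _ = inj₂ (reflect-beyond (rank M ∸ rk M F) (charPoly (contract M F)) (subst (_< suc g) (sym corank≡0) (s≤s z≤n)))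
    factor i zero    e = inj₁ (Q-degree (restrict-isMatroid mat F)
      (subst₂ (λ r i → r < 2 * i) (sym (trans (rank-restrict M F) s)) (trans (sym e) (ℕₚ.+-identityʳ i)) h))

  upper-half : ∀ j {r} → 2 * j < r → r < 2 * (r ∸ j)
  upper-half j {r} h = subst₂ _<_ (ℕₚ.m∸n+n≡m j≤r) (cong ((r ∸ j) +_) (sym (ℕₚ.+-identityʳ (r ∸ j))))
    (ℕₚ.+-monoʳ-< (r ∸ j) (ℕₚ.+-cancelʳ-< j j (r ∸ j)
      (subst₂ _<_ (cong (j +_) (ℕₚ.+-identityʳ j)) (sym (ℕₚ.m∸n+n≡m j≤r)) h)))
    where
    j≤r : j ≤ r
    j≤r = ℕₚ.<⇒≤ (ℕₚ.≤-<-trans (ℕₚ.m≤m+n j (j + 0)) h)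

  reflect-upper : ∀ {r j} p → 2 * j < r → reflect r p (r ∸ j) ≡ p j
  reflect-upper {r} {j} p h = trans (cong (λ d → reflect d p (r ∸ j))
    (sym (ℕₚ.m∸n+n≡m (ℕₚ.<⇒≤ (ℕₚ.≤-<-trans (ℕₚ.m≤m+n j (j + 0)) h))))) (reflect-at (r ∸ j) j p)

  module _ {m : ℕ} where

    -- Below half the rank, the recursion expresses the coefficient of t^j as the coefficient of
    -- t^(r - j) in a sum whose only terms involving minors of full rank have degree less than r - j.
    P-ext : ∀ {r₁ r₂ : Subset m → ℕ} → IsMatroid (mkRankFn m r₁) → IsMatroid (mkRankFn m r₂) →
            r₁ ≗ʳ r₂ → P (mkRankFn m r₁) ≈ P (mkRankFn m r₂)
    P-ext {r₁} m₁ m₂ eq = go (suc (r₁ ⊤)) m₁ m₂ eq ℕₚ.≤-refl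
      where
      go : ∀ k {r₁ r₂ : Subset m → ℕ} → IsMatroid (mkRankFn m r₁) → IsMatroid (mkRankFn m r₂) →
           r₁ ≗ʳ r₂ → r₁ ⊤ < k → P (mkRankFn m r₁) ≈ P (mkRankFn m r₂)
      go (suc k) {r₁} {r₂} m₁ m₂ eq (s≤s r≤k) j = rank-cases (r₁ ⊤)
        (λ z → trans (rank0-P kl _ m₁ z j) (sym (rank0-P kl _ m₂ (trans (sym (eq ⊤)) z) j)))
        positive
        where
        open ≡-Reasoning
        M₁ M₂ : RankFn
        M₁ = mkRankFn m r₁
        M₂ = mkRankFn m r₂
        positive : 0 < r₁ ⊤ → P M₁ j ≡ P M₂ j
        positive p with 2 * j ℕₚ.<? r₁ ⊤
        ... | no  h = trans (deg-P kl M₁ m₁ p j (ℕₚ.≮⇒≥ h))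
          (sym (deg-P kl M₂ m₂ (subst (0 <_) (eq ⊤) p) j (subst (_≤ 2 * j) (eq ⊤) (ℕₚ.≮⇒≥ h))))
        ... | yes h = begin
          P M₁ j                                    ≡⟨ reflect-upper (P M₁) h ⟨
          reflect (r₁ ⊤) (P M₁) l                   ≡⟨ P-recursion m₁ l ⟩
          ∑ˢ (λ F → isFlat M₁ F ▷ P-term M₁ F l)    ≡⟨ ∑-cong (allSubsets m) (λ F → cong₂ _▷_ (isFlat-ext eq F) (term F)) ⟩
          ∑ˢ (λ F → isFlat M₂ F ▷ P-term M₂ F l)    ≡⟨ P-recursion m₂ l ⟨
          reflect (r₂ ⊤) (P M₂) l                   ≡⟨ cong (λ r → reflect r (P M₂) l) (eq ⊤) ⟨
          reflect (r₁ ⊤) (P M₂) l                   ≡⟨ reflect-upper (P M₂) h ⟩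
          P M₂ j                                    ∎
          where
          l : ℕ
          l = r₁ ⊤ ∸ j
          term : ∀ F → P-term M₁ F l ≡ P-term M₂ F l
          term F = rank-cases (r₁ F)
            (λ z → trans (P-term-rank0 m₁ {F} {l} z (upper-half j h))
              (sym (P-term-rank0 m₂ {F} {l} (trans (sym (eq F)) z) (subst (_< 2 * l) (eq ⊤) (upper-half j h)))))
            (λ 0<rF → ⊛-cong
              (charPoly-ext (λ A → eq (A ∩ F)))
              (go k (contract-isMatroid m₁ F) (contract-isMatroid m₂ F)
                (λ A → cong₂ _∸_ (eq (A ∪ F)) (eq F))
                (ℕₚ.<-≤-trans (subst (_< r₁ ⊤) (sym (rank-contract M₁ F))
                  (ℕₚ.∸-monoʳ-< {r₁ ⊤} 0<rF (rk-mono m₁ (⊤-greatest F)))) r≤k))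
              l)

    Q-ext : ∀ {r₁ r₂ : Subset m → ℕ} → IsMatroid (mkRankFn m r₁) → IsMatroid (mkRankFn m r₂) →
            r₁ ≗ʳ r₂ → Q (mkRankFn m r₁) ≈ Q (mkRankFn m r₂)
    Q-ext {r₁} m₁ m₂ eq = go (suc (r₁ ⊤)) m₁ m₂ eq ℕₚ.≤-refl
      where
      go : ∀ k {r₁ r₂ : Subset m → ℕ} → IsMatroid (mkRankFn m r₁) → IsMatroid (mkRankFn m r₂) →
           r₁ ≗ʳ r₂ → r₁ ⊤ < k → Q (mkRankFn m r₁) ≈ Q (mkRankFn m r₂)
      go (suc k) {r₁} {r₂} m₁ m₂ eq (s≤s r≤k) j = rank-cases (r₁ ⊤)
        (λ z → trans (rank0-Q kl _ m₁ z j) (sym (rank0-Q kl _ m₂ (trans (sym (eq ⊤)) z) j)))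
        positive
        where
        open ≡-Reasoning
        M₁ M₂ : RankFn
        M₁ = mkRankFn m r₁
        M₂ = mkRankFn m r₂
        positive : 0 < r₁ ⊤ → Q M₁ j ≡ Q M₂ j
        positive p with 2 * j ℕₚ.<? r₁ ⊤
        ... | no  h = trans (deg-Q kl M₁ m₁ p j (ℕₚ.≮⇒≥ h))
          (sym (deg-Q kl M₂ m₂ (subst (0 <_) (eq ⊤) p) j (subst (_≤ 2 * j) (eq ⊤) (ℕₚ.≮⇒≥ h))))
        ... | yes h = begin
          Q M₁ j                     ≡⟨ reflect-upper (Q M₁) h ⟨
          reflect (r₁ ⊤) (Q M₁) l    ≡⟨ sgn-cancel (r₁ ⊤) reflected ⟩
          reflect (r₁ ⊤) (Q M₂) l    ≡⟨ reflect-upper (Q M₂) h ⟩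
          Q M₂ j                     ∎
          where
          l : ℕ
          l = r₁ ⊤ ∸ j
          term : ∀ F → Q-term M₁ F l ≡ Q-term M₂ F l
          term F with r₁ F ℕₚ.<? r₁ ⊤
          ... | no  r≮r = trans (Q-term-spanning m₁ {F} {l} spanning (upper-half j h))
            (sym (Q-term-spanning m₂ {F} {l} (trans (sym (eq F)) (trans spanning (eq ⊤)))
                   (subst (_< 2 * l) (eq ⊤) (upper-half j h))))
            where
            spanning : r₁ F ≡ r₁ ⊤
            spanning = ℕₚ.≤-antisym (rk-mono m₁ (⊤-greatest F)) (ℕₚ.≮⇒≥ r≮r)
          ... | yes r<r = ⊛-cong
            (go k (restrict-isMatroid m₁ F) (restrict-isMatroid m₂ F) (λ A → eq (A ∩ F))
              (ℕₚ.<-≤-trans (subst (_< r₁ ⊤) (sym (rank-restrict M₁ F)) r<r) r≤k))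
            (λ i → trans
              (cong (λ d → reflect d (charPoly (contract M₁ F)) i) (cong₂ _∸_ (eq ⊤) (eq F)))
              (reflect-cong (r₂ ⊤ ∸ r₂ F) (charPoly-ext (λ A → cong₂ _∸_ (eq (A ∪ F)) (eq F))) i))
            l
          reflected : sgn (r₁ ⊤) *ℤ reflect (r₁ ⊤) (Q M₁) l ≡ sgn (r₁ ⊤) *ℤ reflect (r₁ ⊤) (Q M₂) l
          reflected = begin
            sgn (r₁ ⊤) *ℤ reflect (r₁ ⊤) (Q M₁) l
              ≡⟨ Q-recursion m₁ l ⟩
            ∑ˢ (λ F → isFlat M₁ F ▷ (sgn (r₁ F) *ℤ Q-term M₁ F l))
              ≡⟨ ∑-cong (allSubsets m) (λ F → cong₂ _▷_ (isFlat-ext eq F)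
                   (cong₂ _*ℤ_ (cong sgn (eq F)) (term F))) ⟩
            ∑ˢ (λ F → isFlat M₂ F ▷ (sgn (r₂ F) *ℤ Q-term M₂ F l))
              ≡⟨ Q-recursion m₂ l ⟨
            sgn (r₂ ⊤) *ℤ reflect (r₂ ⊤) (Q M₂) l
              ≡⟨ cong (λ r → sgn r *ℤ reflect r (Q M₂) l) (eq ⊤) ⟨
            sgn (r₁ ⊤) *ℤ reflect (r₁ ⊤) (Q M₂) l ∎

-- The palindromic sum and its middle coefficients

rk-⊥ : ∀ {M} → IsMatroid M → rk M ⊥ ≡ 0
rk-⊥ {M} mat = ℕₚ.n≤0⇒n≡0 (subst (rk M ⊥ ≤_) (Sₚ.∣⊥∣≡0 (n M)) (R1 mat ⊥))

rk-subadditive : ∀ {M} → IsMatroid M → ∀ A B → rk M (A ∪ B) ≤ rk M A + rk M B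
rk-subadditive mat A B = ℕₚ.≤-trans (ℕₚ.m≤m+n _ _) (R3 mat A B)

-- Dropping the first element of the ground set replaces `f` by `f ∘ (false ∷_)`, which inherits
-- subadditivity; hence the induction over arbitrary such `f`. For `rk M` it shows that the loops
-- together have rank 0.
subadditive-null : ∀ {n} (f : Subset n → ℕ) → f ⊥ ≡ 0 → (∀ A B → f (A ∪ B) ≤ f A + f B) →
                   ∀ X → (∀ i → lookup X i ≡ true → f ⁅ i ⁆ ≡ 0) → f X ≡ 0
subadditive-null f f⊥ sub []          h = f⊥
subadditive-null f f⊥ sub (false ∷ X) h =
  subadditive-null (f ∘ (false ∷_)) f⊥ (λ A B → sub (false ∷ A) (false ∷ B)) X (h ∘ suc)
subadditive-null f f⊥ sub (true ∷ X)  h = ℕₚ.n≤0⇒n≡0 (begin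
  f (true ∷ X)                     ≡⟨ cong (λ Y → f (true ∷ Y)) (Sₚ.∪-identityˡ X) ⟨
  f (⁅ zero ⁆ ∪ (false ∷ X))       ≤⟨ sub ⁅ zero ⁆ (false ∷ X) ⟩
  f ⁅ zero ⁆ + f (false ∷ X)       ≡⟨ cong₂ _+_ (h zero refl)
    (subadditive-null (f ∘ (false ∷_)) f⊥ (λ A B → sub (false ∷ A) (false ∷ B)) X (h ∘ suc)) ⟩
  0                                ∎)
  where open ℕₚ.≤-Reasoning

loop : ∀ {M} → IsMatroid M → ∀ {i} → lookup (bot M) i ≡ true → rk M ⁅ i ⁆ ≡ 0
loop {M} mat {i} h = begin
  rk M ⁅ i ⁆        ≡⟨ cong (rk M) (Sₚ.∪-identityˡ ⁅ i ⁆) ⟨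
  rk M (⊥ ∪ ⁅ i ⁆)  ≡⟨ ℕₚ.≡ᵇ⇒≡ _ _ (true⇒T (trans (sym (lookup-bot M i)) h)) ⟩
  rk M ⊥            ≡⟨ rk-⊥ mat ⟩
  0                 ∎
  where open ≡-Reasoning

loop⁻¹ : ∀ {M} → IsMatroid M → ∀ {i} → rk M ⁅ i ⁆ ≡ 0 → lookup (bot M) i ≡ true
loop⁻¹ {M} mat {i} h = trans (lookup-bot M i) (T⇒true (ℕₚ.≡⇒≡ᵇ _ _
  (trans (cong (rk M) (Sₚ.∪-identityˡ ⁅ i ⁆)) (trans h (sym (rk-⊥ mat))))))

rk-bot : ∀ {M} → IsMatroid M → rk M (bot M) ≡ 0
rk-bot {M} mat = subadditive-null (rk M) (rk-⊥ mat) (rk-subadditive mat) (bot M) (λ i → loop mat)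

Flat-bot : ∀ {M} → IsMatroid M → Flat M (bot M)
Flat-bot {M} mat i i∉bot = subst (_< rk M (bot M ∪ ⁅ i ⁆)) (sym (rk-bot mat)) (ℕₚ.n≢0⇒n>0 λ z →
  true≢false (loop⁻¹ mat (ℕₚ.n≤0⇒n≡0 (subst (rk M ⁅ i ⁆ ≤_) z (rk-mono mat (∪-upperʳ (bot M) ⁅ i ⁆))))) i∉bot)

Flat-⊤ : ∀ M → Flat M ⊤
Flat-⊤ M i i∉⊤ = true≢false (Vₚ.lookup-replicate i true) i∉⊤

-- Together with `Flat-spanning⇒⊤` this places the rank of every other flat strictly between 0 and
-- `rank M`, so that both of its minors have positive rank and satisfy `deg-P` and `deg-Q`.
Flat-rank0⇒bot : ∀ {M} → IsMatroid M → ∀ {F} → Flat M F → rk M F ≡ 0 → F ≡ bot M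
Flat-rank0⇒bot {M} mat {F} flatF z = ≼-antisym
  (incl λ i i∈F → loop⁻¹ mat (ℕₚ.n≤0⇒n≡0 (subst (rk M ⁅ i ⁆ ≤_) z (rk-mono mat (⁅⁆-≼ i∈F)))))
  (incl contains)
  where
  contains : ∀ i → lookup (bot M) i ≡ true → lookup F i ≡ true
  contains i i∈bot with lookup F i in i∈F
  ... | true  = refl
  ... | false = ⊥-elim (ℕₚ.<⇒≱ (flatF i i∈F)
    (subst (rk M (F ∪ ⁅ i ⁆) ≤_) (trans (cong (rk M F +_) (loop mat i∈bot)) (ℕₚ.+-identityʳ _))
      (rk-subadditive mat F ⁅ i ⁆)))

Flat-spanning⇒⊤ : ∀ {M} → IsMatroid M → ∀ {F} → Flat M F → rk M F ≡ rank M → F ≡ ⊤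
Flat-spanning⇒⊤ {M} mat {F} flatF s = ≼-antisym (⊤-greatest F) (incl contains)
  where
  contains : ∀ i → lookup ⊤ i ≡ true → lookup F i ≡ true
  contains i _ with lookup F i in i∈F
  ... | true  = refl
  ... | false = ⊥-elim (ℕₚ.<⇒≱ (flatF i i∈F)
    (subst (rk M (F ∪ ⁅ i ⁆) ≤_) (sym s) (rk-mono mat (⊤-greatest (F ∪ ⁅ i ⁆)))))

module Palindrome (P Q : RankFn → Poly) (kl : IsKLPair P Q) (M : RankFn) (mat : IsMatroid M) where

  open KL P Q kl
  open Incidence M mat

  r : ℕ
  r = rank M

  rk≤r : ∀ F → rk M F ≤ r
  rk≤r F = rk-mono mat (⊤-greatest F)

  -- The formal degree of the reflection varies with the entry: the corank of `F` here, the rank of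
  -- `G` in `qʳ`. Along a product the two add up to `r`.
  p pʳ : Matrix (Subset (n M)) Unit.⊤
  p  F _ = mask (isFlat M F) (P (contract M F))
  pʳ F _ = mask (isFlat M F) (reflect (r ∸ rk M F) (P (contract M F)))

  q qʳ : Matrix Unit.⊤ (Subset (n M))
  q  _ G = mask (isFlat M G) (sgn (rk M G) · Q (restrict M G))
  qʳ _ G = mask (isFlat M G) (sgn (rk M G) · reflect (rk M G) (Q (restrict M G)))

  -- Row `F` is the recursion for `contract M F`. Its inner minors are double contractions, which
  -- `P-ext` replaces by the single contraction at `H`.
  pʳ≋Upper⊙p : pʳ ≋ Upper ⊙ p
  pʳ≋Upper⊙p F u j = begin
    isFlat M F ▷ reflect (r ∸ rk M F) (P (contract M F)) j
      ≡⟨ cong (isFlat M F ▷_) (trans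
           (cong (λ d → reflect d (P (contract M F)) j) (sym (rank-contract M F)))
           (P-recursion (contract-isMatroid mat F) j)) ⟩
    isFlat M F ▷ ∑ˢ (λ H → isFlat (contract M F) H ▷ P-term (contract M F) H j)
      ≡⟨ ∑-▷ subsets (isFlat M F) _ ⟨
    ∑ˢ (λ H → isFlat M F ▷ isFlat (contract M F) H ▷ P-term (contract M F) H j)
      ≡⟨ ∑-cong subsets term ⟩
    ∑ˢ (λ H → (Upper F H ⊛ p H u) j) ∎
    where
    open ≡-Reasoning
    contract² : ∀ {H} → F ≼ H → ∀ A → rk (contract (contract M F) H) A ≡ rk (contract M H) A
    contract² {H} F≼H A = trans
      (cong₂ _∸_ (rk-contract M (≼-trans F≼H (∪-upperʳ A H))) (rk-contract M F≼H))
      (∸-∸-cancel (rk-mono mat F≼H) (rk-mono mat (≼-trans F≼H (∪-upperʳ A H))))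
    term : ∀ H → isFlat M F ▷ isFlat (contract M F) H ▷ P-term (contract M F) H j ≡ (Upper F H ⊛ p H u) j
    term H = begin
      isFlat M F ▷ isFlat (contract M F) H ▷ P-term (contract M F) H j
        ≡⟨ ▷-∧ (isFlat M F) (isFlat (contract M F) H) ⟨
      (isFlat M F ∧ isFlat (contract M F) H) ▷ P-term (contract M F) H j
        ≡⟨ ▷-cong (cong (isFlat M F ∧_) (isFlat-contract mat F H)) (λ _ → refl) ⟩
      leF F H ▷ P-term (contract M F) H j
        ≡⟨ ▷-congʳ (leF F H) (λ e → trans
             (⊛-congˡ (charPoly (restrict (contract M F) H))
               (P-ext (contract-isMatroid (contract-isMatroid mat F) H) (contract-isMatroid mat H)
                      (contract² (leF⇒≼ {F} {H} e))) j)
             (sym (cong (_▷ (charPoly (restrict (contract M F) H) ⊛ P (contract M H)) j) (leF-flatʳ {F} {H} e)))) ⟩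
      leF F H ▷ isFlat M H ▷ (charPoly (restrict (contract M F) H) ⊛ P (contract M H)) j
        ≡⟨ ⊛-mask-mask (leF F H) (isFlat M H) (charPoly (restrict (contract M F) H)) (P (contract M H)) j ⟨
      (Upper F H ⊛ p H u) j ∎

  -- Column `G` is the recursion for `restrict M G`, with its flats pulled back to flats of `M`
  -- inside `G` and its double restrictions replaced through `Q-ext`. The signs of the recursion are
  -- those built into `q` and `qʳ`.
  qʳ≋q⊙Lower : qʳ ≋ q ⊙ Lower
  qʳ≋q⊙Lower u G j = begin
    isFlat M G ▷ (sgn (rk M G) *ℤ reflect (rk M G) (Q (restrict M G)) j)
      ≡⟨ ▷-congʳ (isFlat M G) (λ e → trans
           (cong (λ d → sgn d *ℤ reflect d (Q (restrict M G)) j) (sym (rank-restrict M G)))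
           (trans (Q-recursion (restrict-isMatroid mat G) j) (reindex (isFlat⇒Flat M G e)))) ⟩
    isFlat M G ▷ ∑ˢ (λ A → isFlat M A ▷ (A ⊆ᵇ G) ▷ v A)
      ≡⟨ ∑-▷ subsets (isFlat M G) _ ⟨
    ∑ˢ (λ A → isFlat M G ▷ isFlat M A ▷ (A ⊆ᵇ G) ▷ v A)
      ≡⟨ ∑-cong subsets term ⟩
    ∑ˢ (λ A → (q u A ⊛ Lower A G) j) ∎
    where
    open ≡-Reasoning
    χ : Subset (n M) → Poly
    χ A = reflect (rk M G ∸ rk M A) (charPoly (contract (restrict M G) (A ∪ ∁ G)))
    v : Subset (n M) → ℤ
    v A = sgn (rk M A) *ℤ (Q (restrict M A) ⊛ χ A) j
    restrict² : ∀ {A} → A ≼ G → ∀ B → rk (restrict (restrict M G) (A ∪ ∁ G)) B ≡ rk (restrict M A) B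
    restrict² {A} A≼G B = cong (rk M) (trans (Sₚ.∩-assoc B (A ∪ ∁ G) G) (cong (B ∩_) (∪∁-∩ A≼G)))
    reindex : Flat M G →
      ∑ˢ (λ K → isFlat (restrict M G) K ▷ (sgn (rk (restrict M G) K) *ℤ Q-term (restrict M G) K j)) ≡
      ∑ˢ (λ A → isFlat M A ▷ (A ⊆ᵇ G) ▷ v A)
    reindex flatG = ∑-restrict mat flatG
      (λ K → sgn (rk (restrict M G) K) *ℤ Q-term (restrict M G) K j) (λ A → (A ⊆ᵇ G) ▷ v A)
      (λ A i i∉G i∈A → cong (_▷ v A) (⊆ᵇ-outside A G i∉G i∈A))
      (λ A A≼G → trans
        (cong₂ _*ℤ_ (cong sgn (rk-restrict M A≼G))
          (⊛-cong
            (Q-ext (restrict-isMatroid (restrict-isMatroid mat G) (A ∪ ∁ G)) (restrict-isMatroid mat A) (restrict² A≼G))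
            (λ i → cong (λ d → reflect d (charPoly (contract (restrict M G) (A ∪ ∁ G))) i)
                        (cong₂ _∸_ (rank-restrict M G) (rk-restrict M A≼G))) j))
        (sym (cong (_▷ v A) (≼⇒⊆ᵇ A≼G))))
    term : ∀ A → isFlat M G ▷ isFlat M A ▷ (A ⊆ᵇ G) ▷ v A ≡ (q u A ⊛ Lower A G) j
    term A = begin
      isFlat M G ▷ isFlat M A ▷ (A ⊆ᵇ G) ▷ v A
        ≡⟨ regroup (isFlat M G) (isFlat M A) (A ⊆ᵇ G) ⟩
      isFlat M A ▷ leF A G ▷ v A
        ≡⟨ cong (λ w → isFlat M A ▷ leF A G ▷ w) (⊛-·ˡ (sgn (rk M A)) (Q (restrict M A)) (χ A) j) ⟨
      isFlat M A ▷ leF A G ▷ ((sgn (rk M A) · Q (restrict M A)) ⊛ χ A) j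
        ≡⟨ ⊛-mask-mask (isFlat M A) (leF A G) (sgn (rk M A) · Q (restrict M A)) (χ A) j ⟨
      (q u A ⊛ Lower A G) j ∎
      where
      regroup : ∀ a b c {w} → a ▷ b ▷ c ▷ w ≡ b ▷ (b ∧ a ∧ c) ▷ w
      regroup true  true  c = refl
      regroup true  false c = refl
      regroup false true  c = refl
      regroup false false c = refl

  QP : Poly
  QP = (q ⊙ p) Unit.tt Unit.tt

  qʳ⊙pʳ≋q⊙p : qʳ ⊙ pʳ ≋ q ⊙ p
  qʳ⊙pʳ≋q⊙p = ≋-trans (⊙-congʳ pʳ qʳ≋q⊙Lower) (≋-trans (⊙-congˡ (q ⊙ Lower) pʳ≋Upper⊙p)
    (≋-trans (⊙-assoc q Lower (Upper ⊙ p)) (⊙-congˡ q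
      (≋-trans (≋-sym (⊙-assoc Lower Upper p)) (≋-trans (⊙-congʳ p Lower-⊙-Upper)
        (Id-⊙ p (λ F _ h j → cong (_▷ P (contract M F) j) h)))))))

  q-degree : ∀ G {j} → rk M G < 2 * j → q Unit.tt G j ≡ 0ℤ
  q-degree G {j} h = ▷-zero (isFlat M G) (λ _ → trans
    (cong (sgn (rk M G) *ℤ_) (Q-degree (restrict-isMatroid mat G) {j} (subst (_< 2 * j) (sym (rank-restrict M G)) h)))
    (ℤₚ.*-zeroʳ (sgn (rk M G))))

  p-degree : ∀ G {j} → r ∸ rk M G < 2 * j → p G Unit.tt j ≡ 0ℤ
  p-degree G {j} h = ▷-zero (isFlat M G) (λ _ →
    P-degree (contract-isMatroid mat G) {j} (subst (_< 2 * j) (sym (rank-contract M G)) h))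

  -- Splitting `r` as `rk M G + (r ∸ rk M G)` reflects each product factor by factor, so the
  -- reflected sum is `qʳ ⊙ pʳ`.
  QP-palindromic : reflect r QP ≈ QP
  QP-palindromic j = begin
    reflect r QP j
      ≡⟨ reflect-∑ r subsets (λ G → q Unit.tt G ⊛ p G Unit.tt) j ⟩
    ∑ˢ (λ G → reflect r (q Unit.tt G ⊛ p G Unit.tt) j)
      ≡⟨ ∑-cong subsets term ⟩
    (qʳ ⊙ pʳ) Unit.tt Unit.tt j
      ≡⟨ qʳ⊙pʳ≋q⊙p Unit.tt Unit.tt j ⟩
    QP j ∎
    where
    open ≡-Reasoning
    term : ∀ G → reflect r (q Unit.tt G ⊛ p G Unit.tt) j ≡ (qʳ Unit.tt G ⊛ pʳ G Unit.tt) j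
    term G = begin
      reflect r (q Unit.tt G ⊛ p G Unit.tt) j
        ≡⟨ cong (λ d → reflect d (q Unit.tt G ⊛ p G Unit.tt) j) (ℕₚ.m+[n∸m]≡n (rk≤r G)) ⟨
      reflect (rk M G + (r ∸ rk M G)) (q Unit.tt G ⊛ p G Unit.tt) j
        ≡⟨ reflect-⊛ (rk M G) (r ∸ rk M G) (q Unit.tt G) (p G Unit.tt)
             (λ i h → q-degree G {i} (ℕₚ.<-≤-trans h (ℕₚ.m≤m+n i (i + 0))))
             (λ i h → p-degree G {i} (ℕₚ.<-≤-trans h (ℕₚ.m≤m+n i (i + 0)))) j ⟩
      (reflect (rk M G) (q Unit.tt G) ⊛ reflect (r ∸ rk M G) (p G Unit.tt)) j
        ≡⟨ ⊛-cong
             (λ i → trans (reflect-mask (rk M G) (isFlat M G) (sgn (rk M G) · Q (restrict M G)) i)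
                          (cong (isFlat M G ▷_) (reflect-· (rk M G) (sgn (rk M G)) (Q (restrict M G)) i)))
             (reflect-mask (r ∸ rk M G) (isFlat M G) (P (contract M G))) j ⟩
      (qʳ Unit.tt G ⊛ pʳ G Unit.tt) j ∎

  module _ (k : ℕ) (r-odd : r ≡ 2 * k + 1) where

    -- Two nonvanishing factors would have `2 * i ≤ rk M G` and `2 * l ≤ r ∸ rk M G`, hence
    -- `2 * k + 2 ≤ 2 * k + 1`. These weak bounds hold for every flat, the extreme ones included.
    QP-above-middle : QP (suc k) ≡ 0ℤ
    QP-above-middle = ∑-zero subsets (λ G →
      ⊛-vanish (q Unit.tt G) (p G Unit.tt) (suc k) (factor G))
      where
      factor : ∀ G i l → i + l ≡ suc k → q Unit.tt G i ≡ 0ℤ ⊎ p G Unit.tt l ≡ 0ℤ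
      factor G i l e with rk M G ℕₚ.<? 2 * i | r ∸ rk M G ℕₚ.<? 2 * l
      ... | yes h | _     = inj₁ (q-degree G {i} h)
      ... | no  _ | yes h = inj₂ (p-degree G {l} h)
      ... | no  a | no  b = ⊥-elim (ℕₚ.<-irrefl refl (begin-strict
        2 * k + 1               <⟨ ℕₚ.≤-reflexive (double k) ⟩
        2 * suc k               ≡⟨ cong (2 *_) e ⟨
        2 * (i + l)             ≡⟨ ℕₚ.*-distribˡ-+ 2 i l ⟩
        2 * i + 2 * l           ≤⟨ ℕₚ.+-mono-≤ (ℕₚ.≮⇒≥ a) (ℕₚ.≮⇒≥ b) ⟩
        rk M G + (r ∸ rk M G)   ≡⟨ ℕₚ.m+[n∸m]≡n (rk≤r G) ⟩
        r                       ≡⟨ r-odd ⟩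
        2 * k + 1               ∎))
        where
        open ℕₚ.≤-Reasoning
        double : ∀ k → suc (2 * k + 1) ≡ 2 * suc k
        double = solveℕ

    QP-middle : QP k ≡ 0ℤ
    QP-middle = begin
      QP k                        ≡⟨ reflect-at (suc k) k QP ⟨
      reflect (suc k + k) QP (suc k)  ≡⟨ cong (λ d → reflect d QP (suc k)) (trans (double k) (sym r-odd)) ⟩
      reflect r QP (suc k)        ≡⟨ QP-palindromic (suc k) ⟩
      QP (suc k)                  ≡⟨ QP-above-middle ⟩
      0ℤ                         ∎
      where
      open ≡-Reasoning
      double : ∀ k → suc k + k ≡ 2 * k + 1
      double = solveℕ

    bot-term : (q Unit.tt (bot M) ⊛ p (bot M) Unit.tt) k ≡ P M k
    bot-term = trans (⊛-cong {q = p (bot M) Unit.tt} q-bot p-bot k) (one-⊛ (P M) k)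
      where
      flat : isFlat M (bot M) ≡ true
      flat = Flat⇒isFlat M (bot M) (Flat-bot mat)
      q-bot : q Unit.tt (bot M) ≈ one
      q-bot j = trans (cong₂ (λ b d → b ▷ (sgn d · Q (restrict M (bot M))) j) flat (rk-bot mat))
        (trans (ℤₚ.*-identityˡ _)
          (rank0-Q kl (restrict M (bot M)) (restrict-isMatroid mat (bot M)) (trans (rank-restrict M (bot M)) (rk-bot mat)) j))
      contract-bot : ∀ A → rk (contract M (bot M)) A ≡ rk M A
      contract-bot A = trans (cong (rk M (A ∪ bot M) ∸_) (rk-bot mat)) (ℕₚ.≤-antisym
        (subst (rk M (A ∪ bot M) ≤_) (trans (cong (rk M A +_) (rk-bot mat)) (ℕₚ.+-identityʳ _)) (rk-subadditive mat A (bot M)))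
        (rk-mono mat (∪-upperˡ A (bot M))))
      p-bot : p (bot M) Unit.tt ≈ P M
      p-bot j = trans (cong (_▷ P (contract M (bot M)) j) flat)
        (P-ext (contract-isMatroid mat (bot M)) mat contract-bot j)

    top-term : (q Unit.tt ⊤ ⊛ p ⊤ Unit.tt) k ≡ -1ℤ *ℤ Q M k
    top-term = trans (⊛-cong {p = q Unit.tt ⊤} q-top p-top k) (⊛-one (-1ℤ · Q M) k)
      where
      flat : isFlat M ⊤ ≡ true
      flat = Flat⇒isFlat M ⊤ (Flat-⊤ M)
      q-top : q Unit.tt ⊤ ≈ -1ℤ · Q M
      q-top j = trans (cong (_▷ (sgn (rk M ⊤) · Q (restrict M ⊤)) j) flat)
        -- Odd rank makes the sign of the top term negative, so the two surviving terms form a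
        -- difference.
        (cong₂ _*ℤ_ (trans (cong sgn r-odd) (sgn-odd k))
          (Q-ext (restrict-isMatroid mat ⊤) mat (λ A → cong (rk M) (Sₚ.∩-identityʳ A)) j))
      p-top : p ⊤ Unit.tt ≈ one
      p-top j = trans (cong (_▷ P (contract M ⊤) j) flat)
        (rank0-P kl (contract M ⊤) (contract-isMatroid mat ⊤)
          (trans (rank-contract M ⊤) (ℕₚ.n∸n≡0 (rk M ⊤))) j)

    -- At exponent `k` the weak bounds no longer contradict each other. Both minors have positive
    -- rank here, so nonvanishing means `2 * i + 1 ≤ rk M G` and `2 * l + 1 ≤ r ∸ rk M G`, again
    -- `2 * k + 2 ≤ 2 * k + 1`.
    proper-term : ∀ G → G ≢ bot M → G ≢ ⊤ → (q Unit.tt G ⊛ p G Unit.tt) k ≡ 0ℤ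
    proper-term G G≢bot G≢⊤ = trans
      (⊛-mask-mask (isFlat M G) (isFlat M G) (sgn (rk M G) · Q (restrict M G)) (P (contract M G)) k)
      (▷-zero (isFlat M G) (λ e → ▷-zero (isFlat M G) (λ _ →
        ⊛-vanish (sgn (rk M G) · Q (restrict M G)) (P (contract M G)) k (factor (isFlat⇒Flat M G e)))))
      where
      factor : Flat M G → ∀ i l → i + l ≡ k →
               (sgn (rk M G) · Q (restrict M G)) i ≡ 0ℤ ⊎ P (contract M G) l ≡ 0ℤ
      factor flatG i l e with rk M G ℕₚ.≤? 2 * i | r ∸ rk M G ℕₚ.≤? 2 * l
      ... | yes h | _ = inj₁ (trans (cong (sgn (rk M G) *ℤ_)
        (deg-Q kl (restrict M G) (restrict-isMatroid mat G)
          (subst (0 <_) (sym (rank-restrict M G)) (ℕₚ.n≢0⇒n>0 (λ z → G≢bot (Flat-rank0⇒bot mat flatG z))))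
          i (subst (_≤ 2 * i) (sym (rank-restrict M G)) h))) (ℤₚ.*-zeroʳ (sgn (rk M G))))
      ... | no _  | yes h = inj₂ (deg-P kl (contract M G) (contract-isMatroid mat G)
          (subst (0 <_) (sym (rank-contract M G)) (ℕₚ.m<n⇒0<n∸m
            (ℕₚ.≤∧≢⇒< (rk≤r G) (λ s → G≢⊤ (Flat-spanning⇒⊤ mat flatG s)))))
          l (subst (_≤ 2 * l) (sym (rank-contract M G)) h))
      ... | no a  | no b  = ⊥-elim (ℕₚ.<-irrefl refl (begin-strict
        2 * k + 1                    <⟨ ℕₚ.≤-reflexive (double k) ⟩
        2 * suc k                    ≡⟨ cong (λ m → 2 * suc m) e ⟨
        2 * suc (i + l)              ≡⟨ split i l ⟩
        suc (2 * i) + suc (2 * l)    ≤⟨ ℕₚ.+-mono-≤ (ℕₚ.≰⇒> a) (ℕₚ.≰⇒> b) ⟩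
        rk M G + (r ∸ rk M G)        ≡⟨ ℕₚ.m+[n∸m]≡n (rk≤r G) ⟩
        r                            ≡⟨ r-odd ⟩
        2 * k + 1                    ∎))
        where
        open ℕₚ.≤-Reasoning
        double : ∀ k → suc (2 * k + 1) ≡ 2 * suc k
        double = solveℕ
        split : ∀ i l → 2 * suc (i + l) ≡ suc (2 * i) + suc (2 * l)
        split = solveℕ

    middle-coefficients-agree : P M k ≡ Q M k
    middle-coefficients-agree = difference (trans (sym (trans
      (∑ˢ-pair (bot M) ⊤ (λ G → (q Unit.tt G ⊛ p G Unit.tt) k) bot≢⊤ proper-term)
      (cong₂ _+ℤ_ bot-term top-term))) QP-middle)
      where
      -- An odd rank is positive, so the two surviving summands really are distinct.
      bot≢⊤ : bot M ≢ ⊤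
      bot≢⊤ e = ℕₚ.m+1+n≢0 (2 * k) (trans (sym r-odd) (trans (cong (rk M) (sym e)) (rk-bot mat)))
      difference : ∀ {a b} → a +ℤ -1ℤ *ℤ b ≡ 0ℤ → a ≡ b
      difference {a} {b} e = ℤₚ.i-j≡0⇒i≡j a b (trans (cong (a +ℤ_) (sym (ℤₚ.-1*i≡-i b))) e)

-- Degrees and non-degeneracy in odd rank

theorem4p1 : (P Q : RankFn → Poly) → IsKLPair P Q →
    (M : RankFn) → IsMatroid M → (k : ℕ) → rank M ≡ 2 * k + 1 →
    (P M ((rank M ∸ 1) / 2) ≡ Q M ((rank M ∸ 1) / 2))
    × (NonDegenerate P M ⇔ HasDegree (Q M) ((rank M ∸ 1) / 2))
theorem4p1 P Q kl M mat k r-odd = at-middle half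
  where
  half : (rank M ∸ 1) / 2 ≡ k
  half = trans (cong (λ r → (r ∸ 1) / 2) r-odd) (trans
    (cong (_/ 2) (trans (ℕₚ.m+n∸n≡m (2 * k) 1) (ℕₚ.*-comm 2 k))) (m*n/n≡m k 2))
  agree : P M k ≡ Q M k
  agree = Palindrome.middle-coefficients-agree P Q kl M mat k r-odd
  positive : 0 < rank M
  positive = subst (0 <_) (trans (ℕₚ.+-comm 1 (2 * k)) (sym r-odd)) (s≤s z≤n)
  above : ∀ {j} → k < j → rank M ≤ 2 * j
  above {j} k<j = subst (_≤ 2 * j) (sym r-odd) (ℕₚ.≤-trans
    (ℕₚ.≤-trans (ℕₚ.n≤1+n _) (ℕₚ.≤-reflexive (double k))) (ℕₚ.*-monoʳ-≤ 2 k<j))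
    where
    double : ∀ k → suc (2 * k + 1) ≡ 2 * suc k
    double = solveℕ
  -- Everything above `t^k` already vanishes by `deg-P`, so degeneracy depends on this single
  -- coefficient.
  degenerate : P M k ≡ 0ℤ → DegLt (P M) k
  degenerate Pk≡0 j k≤j with ℕₚ.m≤n⇒m<n∨m≡n k≤j
  ... | inj₁ k<j  = deg-P kl M mat positive j (above k<j)
  ... | inj₂ refl = Pk≡0
  to : ¬ DegLt (P M) k → HasDegree (Q M) k
  to nondegenerate = Qk≢0 , λ j k<j → deg-Q kl M mat positive j (above k<j)
    where
    Qk≢0 : ¬ (Q M k ≡ 0ℤ)
    Qk≢0 Qk≡0 = nondegenerate (degenerate (trans agree Qk≡0))
  from : HasDegree (Q M) k → ¬ DegLt (P M) k
  from (Qk≢0 , _) deg = Qk≢0 (trans (sym agree) (deg k ℕₚ.≤-refl))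
  -- With the quotient generalised to a variable `d`, matching on `refl` replaces it by `k`
  -- throughout the statement.
  at-middle : ∀ {d} → d ≡ k → (P M d ≡ Q M d) × ((¬ DegLt (P M) d) ⇔ HasDegree (Q M) d)
  at-middle refl = agree , mk⇔ to from
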